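{- Let $\preceq$ be a reflexive binary relation on a subset of the probability measures on Cantor space $2^{\mathbb{N}}$ with full support. Let $\nu$ and $\mu$ be computable probability measures on $2^{\mathbb{N}}$ with full support. If $\mathsf{MR}_2^{\nu}(\preceq, \mathscr{F}_{n+1}, H)$ has $\nu$-measure one and $\nu\preceq \mu$, then $\nu$ is absolutely continuous with respect to $\mu$, i.e. $\nu\ll \mu$.
   Context: A probability measure $\nu$ on Cantor space is identified with the function $\sigma\mapsto\nu(\sigma):=\nu([\sigma])$ on $2^{<\mathbb{N}}$, where $[\sigma]$ is the set of $\omega\in 2^{\mathbb{N}}$ extending $\sigma$. It is computable if the reals $\nu(\sigma)$ are computable uniformly in $\sigma$; it has full support if $\nu(\sigma)>0$ for all $\sigma$. $\omega\upharpoonright n$ is the length-$n$ initial segment of $\omega$. $\mathscr{F}_n$ is the $\sigma$-algebra generated by the sets $[\sigma]$ with $|\sigma|=n$. Hellinger distance: for probability measures $P\ll Q$ on a $\sigma$-algebra, $H(P,Q)=\big(2(1-\mathbb{E}_Q[(\frac{dP}{dQ})^{1/2}])\big)^{1/2}$. For $\nu,\mu$ with full support, $H_{\mathscr{F}_{n+1}}(\nu,\mu)(\omega)$ denotes $H(P,Q)$ where $P,Q$ are the restrictions to $\mathscr{F}_{n+1}$ of the conditional measures $\nu(\cdot\mid[\omega\upharpoonright n])$ and $\mu(\cdot\mid[\omega\upharpoonright n])$, respectively. $\mathsf{MR}^{\nu}_2(\preceq,\mathscr{F}_{n+1},H)$ is the set of $\omega\in2^{\mathbb{N}}$ such that for all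 computable probability measures $\mu'$ with full support and $\nu\preceq\mu'$, one has $\sum_n \big(H_{\mathscr{F}_{n+1}}(\nu,\mu')(\omega)\big)^2<\infty$. -}

module Defs where

open import Level using (0ℓ)
open import Algebra.Bundles using (CommutativeRing)
open import Data.Bool.Base using (Bool; true; false)
open import Data.Fin.Base using (Fin)
open import Data.List.Base using (List; []; _∷_; _∷ʳ_; length; applyUpTo)
open import Data.Maybe.Base as Maybe using (Maybe; just; nothing)
open import Data.Nat.Base as ℕ using (ℕ; zero; suc)
open import Data.Product.Base using (Σ-syntax; ∃; ∃-syntax; _×_; _,_; proj₁)
open import Data.Sum.Base using (_⊎_; inj₁; inj₂; [_,_]′)
open import Data.Vec.Base using (Vec; []; _∷_; lookup)
open import Data.Vec.Relation.Binary.Pointwise.Inductive using (Pointwise)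
open import Function.Base using (_∘_)
open import Relation.Binary.Core using (Rel)
open import Relation.Binary.PropositionalEquality.Core using (_≡_)
open import Relation.Binary.Structures using (IsTotalOrder)
open import Relation.Nullary.Negation.Core using (¬_)
open import Relation.Unary using (Pred; _≐_; ∁; ⋃)

import Algebra.Definitions.RawMonoid as RawMonoidDefs
import Algebra.Properties.Ring as RingProperties
import Relation.Binary.Construct.NonStrictToStrict as ToStrict
import Relation.Binary.Reasoning.Setoid as ≈-Reasoning

------------------------------------------------------------------------
-- Real numbers

-- The real numbers are given axiomatically, as a Dedekind-complete ordered
-- field, which classically is unique up to isomorphism.  Equality is a
-- setoid equality, so that concrete constructions of ℝ are models.

record CompleteOrderedField : Set₁ where
  infix  8 _⁻¹
  infix  4 _≤_
  field
    commutativeRing : CommutativeRing 0ℓ 0ℓ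
  open CommutativeRing commutativeRing public renaming (Carrier to ℝ)
  field
    _⁻¹          : ℝ → ℝ
    _≤_          : Rel ℝ 0ℓ
    1≉0          : ¬ 1# ≈ 0#
    ⁻¹-cong      : ∀ {x y} → x ≈ y → x ⁻¹ ≈ y ⁻¹
    ⁻¹-inverseʳ  : ∀ {x} → ¬ x ≈ 0# → x * x ⁻¹ ≈ 1#
    -- Junk value making division total; it never affects a probability or an expectation.
    0⁻¹          : 0# ⁻¹ ≈ 0#
    isTotalOrder : IsTotalOrder _≈_ _≤_
    +-monoˡ-≤    : ∀ {x y} z → x ≤ y → x + z ≤ y + z
    *-nonNeg     : ∀ {x y} → 0# ≤ x → 0# ≤ y → 0# ≤ x * y
    complete     : (P : Pred ℝ 0ℓ) → ∃ P → (∃[ b ] ∀ {x} → P x → x ≤ b) →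
                   ∃[ s ] (∀ {x} → P x → x ≤ s) ×
                          (∀ b → (∀ {x} → P x → x ≤ b) → s ≤ b)

  open IsTotalOrder isTotalOrder public
    using (total; ≤-respʳ-≈; ≤-respˡ-≈)
    renaming (refl to ≤-refl; trans to ≤-trans; reflexive to ≤-reflexive;
              antisym to ≤-antisym)
  open ToStrict _≈_ _≤_ public using (_<_)
  open RawMonoidDefs +-rawMonoid public using () renaming (_×_ to _·_)

------------------------------------------------------------------------
-- Computability on ℕ: μ-recursive functions

data Code : ℕ → Set where
  zeroᶜ : Code 0
  sucᶜ  : Code 1
  projᶜ : ∀ {k} → Fin k → Code k
  compᶜ : ∀ {k m} → Code m → Vec (Code k) m → Code k
  recᶜ  : ∀ {k} → Code k → Code (2 ℕ.+ k) → Code (1 ℕ.+ k)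
  minᶜ  : ∀ {k} → Code (1 ℕ.+ k) → Code k

infix 4 _[_]↓_

data _[_]↓_ : ∀ {k} → Code k → Vec ℕ k → ℕ → Set where
  zero↓    : zeroᶜ [ [] ]↓ 0
  suc↓     : ∀ {n} → sucᶜ [ n ∷ [] ]↓ suc n
  proj↓    : ∀ {k} {i : Fin k} {xs} → projᶜ i [ xs ]↓ lookup xs i
  comp↓    : ∀ {k m} {f : Code m} {gs : Vec (Code k) m} {xs ys z} →
             Pointwise (λ g y → g [ xs ]↓ y) gs ys → f [ ys ]↓ z →
             compᶜ f gs [ xs ]↓ z
  recZero↓ : ∀ {k} {f : Code k} {g xs y} →
             f [ xs ]↓ y → recᶜ f g [ 0 ∷ xs ]↓ y
  recSuc↓  : ∀ {k} {f : Code k} {g xs n y z} →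
             recᶜ f g [ n ∷ xs ]↓ y → g [ n ∷ y ∷ xs ]↓ z →
             recᶜ f g [ suc n ∷ xs ]↓ z
  min↓     : ∀ {k} {f : Code (1 ℕ.+ k)} {xs n} →
             f [ n ∷ xs ]↓ 0 →
             (∀ i → i ℕ.< n → ∃[ y ] f [ i ∷ xs ]↓ suc y) →
             minᶜ f [ xs ]↓ n

Recursive : ∀ {k} → (Vec ℕ k → ℕ) → Set
Recursive {k} f = Σ[ c ∈ Code k ] (∀ xs → c [ xs ]↓ f xs)

------------------------------------------------------------------------
-- Cantor space

String : Set
String = List Bool

Cantor : Set
Cantor = ℕ → Bool

infix 8 _↾_

_↾_ : Cantor → ℕ → String
ω ↾ n = applyUpTo ω n

[_] : String → Pred Cantor 0ℓ
[ σ ] ω = ω ↾ length σ ≡ σ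

-- [ σ ] ∩ [ τ ] is either empty or a cylinder.
infixr 7 _⊓_

_⊓_ : String → String → Maybe String
[]          ⊓ τ           = just τ
(a ∷ σ)     ⊓ []          = just (a ∷ σ)
(false ∷ σ) ⊓ (false ∷ τ) = Maybe.map (false ∷_) (σ ⊓ τ)
(true ∷ σ)  ⊓ (true ∷ τ)  = Maybe.map (true ∷_) (σ ⊓ τ)
(false ∷ σ) ⊓ (true ∷ τ)  = nothing
(true ∷ σ)  ⊓ (false ∷ τ) = nothing

-- Bijective binary numeration of strings.
⌜_⌝ : String → ℕ
⌜ [] ⌝        = 0
⌜ false ∷ σ ⌝ = 1 ℕ.+ 2 ℕ.* ⌜ σ ⌝
⌜ true ∷ σ ⌝  = 2 ℕ.+ 2 ℕ.* ⌜ σ ⌝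

data Borel : Pred Cantor 0ℓ → Set₁ where
  cylinder   : ∀ σ → Borel [ σ ]
  complement : ∀ {A} → Borel A → Borel (∁ A)
  union      : ∀ {A : ℕ → Pred Cantor 0ℓ} →
               (∀ n → Borel (A n)) → Borel (⋃ ℕ A)
  resp       : ∀ {A B} → A ≐ B → Borel A → Borel B

module OverReals (R : CompleteOrderedField) where
  open CompleteOrderedField R
  open RingProperties ring using (-‿distribˡ-*; -‿distribʳ-*; -‿involutive)

  fromℕ : ℕ → ℝ
  fromℕ n = n · 1#

  2# : ℝ
  2# = fromℕ 2

  infixl 7 _÷_
  _÷_ : ℝ → ℝ → ℝ
  x ÷ y = x * y ⁻¹

  Close : ℝ → ℝ → ℝ → Set
  Close ε x y = x ≤ y + ε × y ≤ x + ε

  ----------------------------------------------------------------------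
  -- Square roots

  0≤1 : 0# ≤ 1#
  0≤1 with total 0# 1#
  ... | inj₁ 0≤1 = 0≤1
  ... | inj₂ 1≤0 = ≤-respʳ-≈ -1*-1≈1 (*-nonNeg 0≤-1 0≤-1)
    where
    0≤-1 : 0# ≤ - 1#
    0≤-1 = ≤-respˡ-≈ (-‿inverseʳ 1#)
             (≤-respʳ-≈ (+-identityˡ (- 1#)) (+-monoˡ-≤ (- 1#) 1≤0))
    -1*-1≈1 : - 1# * - 1# ≈ 1#
    -1*-1≈1 = trans (sym (-‿distribˡ-* 1# (- 1#)))
                (trans (-‿cong (*-identityˡ (- 1#))) (-‿involutive 1#))

  1≤⇒≤² : ∀ {y} → 1# ≤ y → y ≤ y * y
  1≤⇒≤² {y} 1≤y = ≤-respˡ-≈ (+-identityˡ y)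
    (≤-respʳ-≈ cancel (+-monoˡ-≤ y (*-nonNeg (≤-trans 0≤1 1≤y) 0≤y-1)))
    where
    open ≈-Reasoning setoid
    0≤y-1 : 0# ≤ y - 1#
    0≤y-1 = ≤-respˡ-≈ (-‿inverseʳ 1#) (+-monoˡ-≤ (- 1#) 1≤y)
    cancel : y * (y - 1#) + y ≈ y * y
    cancel = begin
      y * (y - 1#) + y            ≈⟨ +-congˡ (sym (*-identityʳ y)) ⟩
      y * (y - 1#) + y * 1#       ≈⟨ sym (distribˡ y (y - 1#) 1#) ⟩
      y * ((y - 1#) + 1#)         ≈⟨ *-congˡ (+-assoc y (- 1#) 1#) ⟩
      y * (y + (- 1# + 1#))       ≈⟨ *-congˡ (+-congˡ (-‿inverseˡ 1#)) ⟩
      y * (y + 0#)                ≈⟨ *-congˡ (+-identityʳ y) ⟩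
      y * y                       ∎

  SqrtCut : ℝ → Pred ℝ 0ℓ
  SqrtCut x y = y ≈ 0# ⊎ y * y ≤ x

  sqrtCut-bounded : ∀ x → ∃[ b ] (∀ {y} → SqrtCut x y → y ≤ b)
  sqrtCut-bounded x with total x 1#
  ... | inj₁ x≤1 = 1# , λ where
    (inj₁ y≈0)  → ≤-respˡ-≈ (sym y≈0) 0≤1
    (inj₂ y²≤x) → [ (λ y≤1 → y≤1)
                  , (λ 1≤y → ≤-trans (1≤⇒≤² 1≤y) (≤-trans y²≤x x≤1)) ]′ (total _ 1#)
  ... | inj₂ 1≤x = x , λ where
    (inj₁ y≈0)  → ≤-respˡ-≈ (sym y≈0) (≤-trans 0≤1 1≤x)
    (inj₂ y²≤x) → [ (λ y≤1 → ≤-trans y≤1 1≤x)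
                  , (λ 1≤y → ≤-trans (1≤⇒≤² 1≤y) y²≤x) ]′ (total _ 1#)

  -- sup { y : y² ≤ x } for x ≥ 0.  The point 0 is added to the set only to
  -- make the function total; it gives sqrt x = 0 for x < 0.
  sqrt : ℝ → ℝ
  sqrt x = proj₁ (complete (SqrtCut x) (0# , inj₁ refl) (sqrtCut-bounded x))

  ----------------------------------------------------------------------
  -- Sums

  ∑[_] : ℕ → (ℕ → ℝ) → ℝ
  ∑[ zero ]  f = 0#
  ∑[ suc n ] f = ∑[ n ] f + f n

  -- ∑ f < ∞, for non-negative f.
  Summable : (ℕ → ℝ) → Set
  Summable f = ∃[ b ] (∀ n → ∑[ n ] f ≤ b)

  ∑-strings : ℕ → (String → ℝ) → ℝ
  ∑-strings zero    f = f []
  ∑-strings (suc m) f = ∑-strings m (f ∘ (false ∷_)) + ∑-strings m (f ∘ (true ∷_))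

  ----------------------------------------------------------------------
  -- Probability measures on Cantor space

  record Measure : Set where
    field
      mass     : String → ℝ
      nonNeg   : ∀ σ → 0# ≤ mass σ
      mass-[]  : mass [] ≈ 1#
      additive : ∀ σ → mass σ ≈ mass (σ ∷ʳ false) + mass (σ ∷ʳ true)
  open Measure public

  FullSupport : Pred Measure 0ℓ
  FullSupport ν = ∀ σ → 0# < mass ν σ

  -- From σ and k one computes integers p, q, d such that the rational
  -- (p - q) / (d + 1) is within 2⁻ᵏ of x σ.
  UniformlyComputable : (String → ℝ) → Set
  UniformlyComputable x =
    ∃[ p ] ∃[ q ] ∃[ d ]
      Recursive p × Recursive q × Recursive d ×
      (∀ σ k → let a = ⌜ σ ⌝ ∷ k ∷ [] in
        Close (fromℕ (2 ℕ.^ k) ⁻¹)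
              (x σ)
              ((fromℕ (p a) - fromℕ (q a)) ÷ fromℕ (suc (d a))))

  Computable : Pred Measure 0ℓ
  Computable ν = UniformlyComputable (mass ν)

  -- The value of a set function at [ σ ], or at ∅.
  mass? : (String → ℝ) → Maybe String → ℝ
  mass? f (just σ) = f σ
  mass? f nothing  = 0#

  -- Countable families of cylinders, some of which may be empty.
  Covers : (ℕ → Maybe String) → ∀ {ℓ} → Pred Cantor ℓ → Set ℓ
  Covers C A = ∀ {ω} → A ω → ∃[ n ] ∃[ σ ] C n ≡ just σ × [ σ ] ω

  -- ν(A) = 0, where ν also denotes the (completed) extension to Borel sets:
  -- its value is the infimum of ∑ₙ ν(Cₙ) over countable covers by cylinders.
  Null : Measure → ∀ {ℓ} → Pred Cantor ℓ → Set ℓ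
  Null ν A = ∀ ε → 0# < ε →
    ∃[ C ] Covers C A × (∀ n → ∑[ n ] (mass? (mass ν) ∘ C) ≤ ε)

  HasMeasureOne : Measure → ∀ {ℓ} → Pred Cantor ℓ → Set ℓ
  HasMeasureOne ν A = Null ν (∁ A)

  infix 4 _≪_
  _≪_ : Measure → Measure → Set₁
  ν ≪ μ = ∀ {A : Pred Cantor 0ℓ} → Borel A → Null μ A → Null ν A

  ----------------------------------------------------------------------
  -- Conditional measures

  mass?-map : ∀ f b m → mass? f (Maybe.map (b ∷_) m) ≈ mass? (f ∘ (b ∷_)) m
  mass?-map f b (just σ) = refl
  mass?-map f b nothing  = refl

  mass?-nonNeg : ∀ f → (∀ σ → 0# ≤ f σ) → ∀ m → 0# ≤ mass? f m
  mass?-nonNeg f 0≤f (just σ) = 0≤f σ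
  mass?-nonNeg f 0≤f nothing  = ≤-refl

  mass?-⊓-additive :
    ∀ f → (∀ σ → f σ ≈ f (σ ∷ʳ false) + f (σ ∷ʳ true)) → ∀ σ τ →
    mass? f (σ ⊓ τ) ≈ mass? f ((σ ∷ʳ false) ⊓ τ) + mass? f ((σ ∷ʳ true) ⊓ τ)
  mass?-⊓-additive f add []          []          = add []
  mass?-⊓-additive f add []          (false ∷ τ) = sym (+-identityʳ _)
  mass?-⊓-additive f add []          (true ∷ τ)  = sym (+-identityˡ _)
  mass?-⊓-additive f add (a ∷ σ)     []          = add (a ∷ σ)
  mass?-⊓-additive f add (false ∷ σ) (true ∷ τ)  = sym (+-identityˡ _)
  mass?-⊓-additive f add (true ∷ σ)  (false ∷ τ) = sym (+-identityˡ _)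
  mass?-⊓-additive f add (false ∷ σ) (false ∷ τ) =
    trans (mass?-map f false (σ ⊓ τ))
      (trans (mass?-⊓-additive (f ∘ (false ∷_)) (add ∘ (false ∷_)) σ τ)
        (sym (+-cong (mass?-map f false ((σ ∷ʳ false) ⊓ τ))
                     (mass?-map f false ((σ ∷ʳ true) ⊓ τ)))))
  mass?-⊓-additive f add (true ∷ σ)  (true ∷ τ)  =
    trans (mass?-map f true (σ ⊓ τ))
      (trans (mass?-⊓-additive (f ∘ (true ∷_)) (add ∘ (true ∷_)) σ τ)
        (sym (+-cong (mass?-map f true ((σ ∷ʳ false) ⊓ τ))
                     (mass?-map f true ((σ ∷ʳ true) ⊓ τ)))))

  ⁻¹-nonNeg : ∀ {x} → 0# < x → 0# ≤ x ⁻¹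
  ⁻¹-nonNeg {x} (0≤x , 0≉x) = ≤-respʳ-≈ cancel (*-nonNeg 0≤x (square (x ⁻¹)))
    where
    square : ∀ y → 0# ≤ y * y
    square y with total 0# y
    ... | inj₁ 0≤y = *-nonNeg 0≤y 0≤y
    ... | inj₂ y≤0 = ≤-respʳ-≈ neg² (*-nonNeg 0≤-y 0≤-y)
      where
      0≤-y : 0# ≤ - y
      0≤-y = ≤-respˡ-≈ (-‿inverseʳ y)
               (≤-respʳ-≈ (+-identityˡ (- y)) (+-monoˡ-≤ (- y) y≤0))
      neg² : - y * - y ≈ y * y
      neg² = trans (sym (-‿distribˡ-* y (- y)))
               (trans (-‿cong (sym (-‿distribʳ-* y y))) (-‿involutive (y * y)))
    cancel : x * (x ⁻¹ * x ⁻¹) ≈ x ⁻¹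
    cancel = trans (sym (*-assoc x (x ⁻¹) (x ⁻¹)))
               (trans (*-congʳ (⁻¹-inverseʳ (0≉x ∘ sym))) (*-identityˡ (x ⁻¹)))

  -- ν( · | [ τ ]), that is, σ ↦ ν([ σ ] ∩ [ τ ]) / ν([ τ ]).
  conditional : (ν : Measure) → FullSupport ν → String → Measure
  conditional ν supp τ = record
    { mass     = λ σ → mass? (mass ν) (σ ⊓ τ) ÷ mass ν τ
    ; nonNeg   = λ σ → *-nonNeg (mass?-nonNeg (mass ν) (nonNeg ν) (σ ⊓ τ))
                                (⁻¹-nonNeg (supp τ))
    ; mass-[]  = ⁻¹-inverseʳ (λ ντ≈0 → let (_ , 0≉ντ) = supp τ in 0≉ντ (sym ντ≈0))
    ; additive = λ σ → trans
        (*-congʳ (mass?-⊓-additive (mass ν) (additive ν) σ τ))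
        (distribʳ _ _ _)
    }

  ----------------------------------------------------------------------
  -- Hellinger distance on 𝓕ₘ, the finite σ-algebra with atoms the [ σ ],
  -- |σ| = m.  An 𝓕ₘ-measurable function is a function of the atom.

  𝔼 : ℕ → Measure → (String → ℝ) → ℝ
  𝔼 m Q X = ∑-strings m (λ σ → mass Q σ * X σ)

  -- dP/dQ on atoms; meaningful for P ≪ Q on 𝓕ₘ, and determined only on atoms
  -- of positive Q-mass.
  density : Measure → Measure → String → ℝ
  density P Q σ = mass P σ ÷ mass Q σ

  hellinger : ℕ → Measure → Measure → ℝ
  hellinger m P Q = sqrt (2# * (1# - 𝔼 m Q (sqrt ∘ density P Q)))

  -- H_{𝓕ₙ₊₁}(ν, μ)(ω)
  H : ∀ n (ν μ : Measure) → FullSupport ν → FullSupport μ → Cantor → ℝ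
  H n ν μ suppν suppμ ω =
    hellinger (suc n) (conditional ν suppν (ω ↾ n)) (conditional μ suppμ (ω ↾ n))

  MR₂ : ∀ {ℓ} → Rel Measure ℓ → (ν : Measure) → FullSupport ν → Pred Cantor ℓ
  MR₂ _≼_ ν suppν ω =
    ∀ μ′ → Computable μ′ → (suppμ′ : FullSupport μ′) → ν ≼ μ′ →
    Summable (λ n → H n ν μ′ suppν suppμ′ ω * H n ν μ′ suppν suppμ′ ω)

{-# OPTIONS --safe #-}

-- Let r σ = √(ν σ · μ σ).  At a node σ the children satisfy
-- r (σ0) + r (σ1) = (1 − x σ) r σ, where 2 x σ is the squared Hellinger distance
-- of the conditional measures on the next bit.  If from level N on every path
-- spends at most δ of x, then ∑ r over the leaves below a node σ of level N
-- is at least (1 − δ) r σ, so ν and the multiple (ν σ / μ σ) μ are Hellinger close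
-- below σ and ν ≤ 2 (ν σ / μ σ) μ + 4 δ ν σ on every clopen set of such paths.
-- For large N the paths spending more than δ after level N form an open set
-- of small ν-measure: otherwise, by compactness, some path outside a small
-- cover of the divergence set spends more than δ after every level.  Hence a
-- cover of A of small μ-measure yields, up to that open set, one of small
-- ν-measure.

module Submission where

open import Defs
open import Level using (Level; 0ℓ)
open import Axiom.ExcludedMiddle using (ExcludedMiddle)
open import Data.Bool.Base using (Bool; true; false)
open import Data.Integer.Base as ℤ using (ℤ; +_; -[1+_]; _⊖_; _◃_)
import Data.Integer.Properties as ℤ
open import Data.List.Base using ([]; _∷_; _∷ʳ_; _++_; length; take; drop)
open import Data.List.Properties
  using (++-identityʳ; ++-assoc; ∷ʳ-++; ∷-injectiveʳ; length-++; length-take; length-applyUpTo;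
         applyUpTo-∷ʳ; take-all; take-take; take++drop≡id)
open import Data.Maybe.Base as Maybe using (Maybe; just; nothing)
open import Data.Nat.Base as ℕ using (ℕ; zero; suc; z≤n; s≤s)
open import Data.Nat.Induction using (<-rec)
import Data.Nat.Properties as ℕ
open import Data.Product.Base using (∃-syntax; _×_; _,_; proj₁; proj₂)
import Data.Sign.Base as Sign
open import Data.Sum.Base using (_⊎_; inj₁; inj₂; [_,_]′)
open import Function.Base using (_∘_)
open import Relation.Binary.Bundles using (Poset)
open import Relation.Binary.Core using (Rel)
open import Relation.Binary.Definitions using (tri<; tri≈; tri>)
open import Relation.Binary.PropositionalEquality.Core as ≡ using (_≡_)
open import Relation.Binary.Structures using (IsTotalOrder)
open import Relation.Nullary.Decidable.Core using (Dec; yes; no; decidable-stable)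
open import Relation.Nullary.Negation.Core using (¬_; contradiction)
open import Relation.Unary using (Pred; _⊆_; ∁)

import Algebra.Properties.Ring as RingProperties
import Algebra.Properties.Semiring.Mult.TCOptimised as Mult
import Algebra.Solver.Ring
import Algebra.Solver.Ring.AlmostCommutativeRing as ACR
import Relation.Binary.Reasoning.PartialOrder as ≤-Reasoning
import Relation.Binary.Reasoning.Setoid as ≈-Reasoning

-- The delicate point is compactness: spending more than δ after level j is an open condition, and
-- compactness alone says nothing about a decreasing sequence of open sets. Each one is therefore
-- cut down to the clopen part already decided at some length `depth j`, at a loss of ν-measure at
-- most ε/2^(j+1). The losses sum to at most ε and the cover of the divergence set costs another ε.
-- An overspending set of measure above ε + ε thus always leaves a string, and König's lemma
-- applies. This is continuity from above done with finite sums only: an open set is a set of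
-- strings closed under extension, measured by its sums over the strings of one length, and it
-- becomes a cover only at the very end. The choices are made in the order δ, N, K, cover of A. K
-- bounds ν σ / μ σ on level N, so a cover of μ-measure δ/K can be requested only once N is fixed.
-- The errors are 2δ from the overspending set, 2δ from the cover and 4δ from the Hellinger
-- estimate, whence δ = ε/8.

-- Ring solver with integer coefficients.

module IntegerRingSolver (R : CompleteOrderedField) where
  open CompleteOrderedField R hiding (zero)
  open RingProperties ring
    using (-‿distribˡ-*; -‿distribʳ-*; -‿involutive; -0#≈0#; -‿+-comm)
  open Mult semiring using (×-homo-+; ×1-homo-*; 1+×) renaming (_×_ to _×′_)

  -- Unlike fromℕ 1, # 1 is definitionally 1#, so the solver's numerals match.
  infix 9 #_
  #_ : ℕ → ℝ
  # n = n ×′ 1#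

  ⟦_⟧ : ℤ → ℝ
  ⟦ + n ⟧      = # n
  ⟦ -[1+ n ] ⟧ = - # suc n

  #-suc : ∀ n → # suc n ≈ 1# + # n
  #-suc n = 1+× n 1#

  ⟦⊖⟧ : ∀ m n → ⟦ m ⊖ n ⟧ ≈ # m - # n
  ⟦⊖⟧ m       zero    = sym (trans (+-congˡ -0#≈0#) (+-identityʳ (# m)))
  ⟦⊖⟧ zero    (suc n) = sym (+-identityˡ _)
  ⟦⊖⟧ (suc m) (suc n) = begin
    ⟦ suc m ⊖ suc n ⟧                  ≡⟨ ≡.cong ⟦_⟧ (ℤ.[1+m]⊖[1+n]≡m⊖n m n) ⟩
    ⟦ m ⊖ n ⟧                          ≈⟨ ⟦⊖⟧ m n ⟩
    # m - # n                          ≈⟨ +-identityˡ _ ⟨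
    0# + (# m - # n)                   ≈⟨ +-congʳ (-‿inverseʳ 1#) ⟨
    1# - 1# + (# m - # n)              ≈⟨ +-assoc _ _ _ ⟩
    1# + (- 1# + (# m - # n))          ≈⟨ +-congˡ (trans (sym (+-assoc _ _ _)) (trans (+-congʳ (+-comm _ _)) (+-assoc _ _ _))) ⟩
    1# + (# m + (- 1# - # n))          ≈⟨ +-assoc _ _ _ ⟨
    1# + # m + (- 1# - # n)            ≈⟨ +-cong (sym (#-suc m)) (trans (-‿+-comm _ _) (-‿cong (sym (#-suc n)))) ⟩
    # suc m - # suc n                  ∎
    where open ≈-Reasoning setoid

  ⟦neg⟧ : ∀ i → ⟦ ℤ.- i ⟧ ≈ - ⟦ i ⟧
  ⟦neg⟧ (+ zero)  = sym -0#≈0#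
  ⟦neg⟧ (+ suc n) = refl
  ⟦neg⟧ -[1+ n ]  = sym (-‿involutive _)

  ⟦+⟧ : ∀ i j → ⟦ i ℤ.+ j ⟧ ≈ ⟦ i ⟧ + ⟦ j ⟧
  ⟦+⟧ (+ m)    (+ n)    = ×-homo-+ 1# m n
  ⟦+⟧ (+ m)    -[1+ n ] = ⟦⊖⟧ m (suc n)
  ⟦+⟧ -[1+ m ] (+ n)    = trans (⟦⊖⟧ n (suc m)) (+-comm _ _)
  ⟦+⟧ -[1+ m ] -[1+ n ] = begin
    - # suc (suc (m ℕ.+ n))  ≈⟨ -‿cong (#-suc (suc m ℕ.+ n)) ⟩
    - (1# + # (suc m ℕ.+ n)) ≈⟨ -‿cong (+-congˡ (×-homo-+ 1# (suc m) n)) ⟩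
    - (1# + (# suc m + # n)) ≈⟨ -‿cong (trans (sym (+-assoc _ _ _)) (trans (+-congʳ (+-comm _ _)) (+-assoc _ _ _))) ⟩
    - (# suc m + (1# + # n)) ≈⟨ -‿cong (+-congˡ (#-suc n)) ⟨
    - (# suc m + # suc n)    ≈⟨ -‿+-comm _ _ ⟨
    - # suc m - # suc n      ∎
    where open ≈-Reasoning setoid

  ⟦-◃⟧ : ∀ n → ⟦ Sign.- ◃ n ⟧ ≈ - # n
  ⟦-◃⟧ zero    = sym -0#≈0#
  ⟦-◃⟧ (suc n) = refl

  ⟦+◃⟧ : ∀ n → ⟦ Sign.+ ◃ n ⟧ ≈ # n
  ⟦+◃⟧ zero    = refl
  ⟦+◃⟧ (suc n) = refl

  ⟦*⟧ : ∀ i j → ⟦ i ℤ.* j ⟧ ≈ ⟦ i ⟧ * ⟦ j ⟧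
  ⟦*⟧ (+ m)    (+ n)    = trans (⟦+◃⟧ (m ℕ.* n)) (×1-homo-* m n)
  ⟦*⟧ (+ m)    -[1+ n ] = trans (⟦-◃⟧ (m ℕ.* suc n))
    (trans (-‿cong (×1-homo-* m (suc n))) (-‿distribʳ-* _ _))
  ⟦*⟧ -[1+ m ] (+ n)    = trans (⟦-◃⟧ (suc m ℕ.* n))
    (trans (-‿cong (×1-homo-* (suc m) n)) (-‿distribˡ-* _ _))
  ⟦*⟧ -[1+ m ] -[1+ n ] = trans (⟦+◃⟧ (suc m ℕ.* suc n)) (trans (×1-homo-* (suc m) (suc n))
    (trans (sym (-‿involutive _)) (trans (-‿cong (-‿distribʳ-* _ _)) (-‿distribˡ-* _ _))))

  almostCommutativeRing : ACR.AlmostCommutativeRing _ _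
  almostCommutativeRing = ACR.fromCommutativeRing commutativeRing

  morphism : ℤ.+-*-rawRing ACR.-Raw-AlmostCommutative⟶ almostCommutativeRing
  morphism = record
    { ⟦_⟧    = ⟦_⟧
    ; +-homo = ⟦+⟧
    ; *-homo = ⟦*⟧
    ; -‿homo = ⟦neg⟧
    ; 0-homo = refl
    ; 1-homo = refl
    }

  ⟦⟧≈? : ∀ i j → Maybe (⟦ i ⟧ ≈ ⟦ j ⟧)
  ⟦⟧≈? i j with i ℤ.≟ j
  ... | yes i≡j = just (reflexive (≡.cong ⟦_⟧ i≡j))
  ... | no  _   = nothing

  open Algebra.Solver.Ring ℤ.+-*-rawRing almostCommutativeRing morphism ⟦⟧≈? public
    using (solve; _:=_; _:+_; _:*_; _:-_; :-_; con; Polynomial)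

-- Ordered-field arithmetic, square roots, suprema.

module OrderedFieldProperties (em : ExcludedMiddle 0ℓ) (R : CompleteOrderedField) where
  open CompleteOrderedField R hiding (zero)
  open OverReals R
  open IntegerRingSolver R

  infix 9 :#_
  :#_ : ∀ {k} → ℕ → Polynomial k
  :# n = con (+ n)

  poset : Poset _ _ _
  poset = record { isPartialOrder = IsTotalOrder.isPartialOrder isTotalOrder }

  infixl 6 _⟨+⟩_
  infixl 7 _⟨*⟩_

  _⟨+⟩_ : ∀ {x y} → 0# ≤ x → 0# ≤ y → 0# ≤ x + y
  0≤x ⟨+⟩ 0≤y = ≤-trans 0≤y (≤-respˡ-≈ (+-identityˡ _) (+-monoˡ-≤ _ 0≤x))

  _⟨*⟩_ : ∀ {x y} → 0# ≤ x → 0# ≤ y → 0# ≤ x * y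
  _⟨*⟩_ = *-nonNeg

  ≤⇒0≤ : ∀ {x y} → x ≤ y → 0# ≤ y - x
  ≤⇒0≤ {x} x≤y = ≤-respˡ-≈ (-‿inverseʳ x) (+-monoˡ-≤ (- x) x≤y)

  ≤-slack : ∀ {x y d} → 0# ≤ d → x + d ≈ y → x ≤ y
  ≤-slack {x} {y} {d} 0≤d eq = ≤-respˡ-≈ (+-identityˡ x)
    (≤-respʳ-≈ (trans (+-comm d x) eq) (+-monoˡ-≤ x 0≤d))

  +-mono-≤ : ∀ {x y u v} → x ≤ y → u ≤ v → x + u ≤ y + v
  +-mono-≤ {x} {y} {u} {v} x≤y u≤v = ≤-slack (≤⇒0≤ x≤y ⟨+⟩ ≤⇒0≤ u≤v)
    (solve 4 (λ x y u v → x :+ u :+ (y :- x :+ (v :- u)) := y :+ v) refl x y u v)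

  *-monoˡ-≤ : ∀ {x y} z → 0# ≤ z → x ≤ y → z * x ≤ z * y
  *-monoˡ-≤ {x} {y} z 0≤z x≤y = ≤-slack (0≤z ⟨*⟩ ≤⇒0≤ x≤y)
    (solve 3 (λ x y z → z :* x :+ z :* (y :- x) := z :* y) refl x y z)

  #-nonNeg : ∀ n → 0# ≤ # n
  #-nonNeg zero    = ≤-refl
  #-nonNeg (suc n) = ≤-respʳ-≈ (sym (#-suc n)) (0≤1 ⟨+⟩ #-nonNeg n)

  <⇒≤ : ∀ {x y} → x < y → x ≤ y
  <⇒≤ = proj₁

  <⇒≱ : ∀ {x y} → x < y → ¬ y ≤ x
  <⇒≱ (x≤y , x≉y) y≤x = x≉y (≤-antisym x≤y y≤x)

  ≰⇒> : ∀ {x y} → ¬ x ≤ y → y < x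
  ≰⇒> {x} {y} x≰y with total x y
  ... | inj₁ x≤y = contradiction x≤y x≰y
  ... | inj₂ y≤x = y≤x , λ y≈x → x≰y (≤-reflexive (sym y≈x))

  <-≤-trans : ∀ {x y z} → x < y → y ≤ z → x < z
  <-≤-trans x<y y≤z = ≤-trans (<⇒≤ x<y) y≤z , λ x≈z → <⇒≱ x<y (≤-respʳ-≈ (sym x≈z) y≤z)

  <⇒0<- : ∀ {x y} → x < y → 0# < y - x
  <⇒0<- {x} {y} (x≤y , x≉y) = ≤⇒0≤ x≤y , λ 0≈y-x → x≉y (sym (trans
    (solve 2 (λ x y → y := y :- x :+ x) refl x y) (trans (+-congʳ (sym 0≈y-x)) (+-identityˡ x))))

  0<⇒< : ∀ {x d} y → 0# < d → x + d ≈ y → x < y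
  0<⇒< {x} {d} y 0<d x+d≈y = ≤-slack (<⇒≤ 0<d) x+d≈y , λ x≈y → proj₂ 0<d (sym (begin
    d         ≈⟨ solve 2 (λ x d → d := x :+ d :- x) refl x d ⟩
    x + d - x ≈⟨ +-cong x+d≈y (-‿cong x≈y) ⟩
    y - y     ≈⟨ -‿inverseʳ y ⟩
    0#        ∎))
    where open ≈-Reasoning setoid

  x-ε<x : ∀ x {ε} → 0# < ε → x - ε < x
  x-ε<x x {ε} 0<ε = 0<⇒< x 0<ε (solve 2 (λ x ε → x :- ε :+ ε := x) refl x ε)

  0<⇒≉0 : ∀ {x} → 0# < x → ¬ x ≈ 0#
  0<⇒≉0 0<x x≈0 = proj₂ 0<x (sym x≈0)

  *-zero-product : ∀ {x y} → ¬ x ≈ 0# → x * y ≈ 0# → y ≈ 0#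
  *-zero-product {x} {y} x≉0 xy≈0 = begin
    y              ≈⟨ *-identityˡ y ⟨
    1# * y         ≈⟨ *-congʳ (⁻¹-inverseʳ x≉0) ⟨
    x * x ⁻¹ * y   ≈⟨ trans (*-assoc _ _ _) (trans (*-congˡ (*-comm _ _)) (sym (*-assoc _ _ _))) ⟩
    x * y * x ⁻¹   ≈⟨ *-congʳ xy≈0 ⟩
    0# * x ⁻¹      ≈⟨ zeroˡ _ ⟩
    0#             ∎
    where open ≈-Reasoning setoid

  *-pos : ∀ {x y} → 0# < x → 0# < y → 0# < x * y
  *-pos 0<x 0<y = <⇒≤ 0<x ⟨*⟩ <⇒≤ 0<y ,
    λ 0≈xy → 0<⇒≉0 0<y (*-zero-product (0<⇒≉0 0<x) (sym 0≈xy))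

  ⁻¹-pos : ∀ {x} → 0# < x → 0# < x ⁻¹
  ⁻¹-pos {x} 0<x = ⁻¹-nonNeg 0<x , λ 0≈x⁻¹ → 1≉0
    (trans (sym (⁻¹-inverseʳ (0<⇒≉0 0<x))) (trans (*-congˡ (sym 0≈x⁻¹)) (zeroʳ x)))

  0<1 : 0# < 1#
  0<1 = 0≤1 , λ 0≈1 → 1≉0 (sym 0≈1)

  #-pos : ∀ n → 0# < # suc n
  #-pos n = <-≤-trans 0<1 (≤-slack (#-nonNeg n) (sym (#-suc n)))

  ÷-pos : ∀ {x} n → 0# < x → 0# < x * (# suc n) ⁻¹
  ÷-pos n 0<x = *-pos 0<x (⁻¹-pos (#-pos n))

  *-÷-cancel : ∀ {x y} → ¬ y ≈ 0# → y * (x * y ⁻¹) ≈ x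
  *-÷-cancel {x} {y} y≉0 = trans
    (solve 3 (λ x y z → y :* (x :* z) := x :* (y :* z)) refl x y (y ⁻¹))
    (trans (*-congˡ (⁻¹-inverseʳ y≉0)) (*-identityʳ x))

  *-cancelˡ-≤0 : ∀ {x y} → 0# < x → 0# ≤ x * y → 0# ≤ y
  *-cancelˡ-≤0 {x} {y} 0<x 0≤xy = ≤-respʳ-≈
    (trans (*-assoc x y (x ⁻¹)) (*-÷-cancel (0<⇒≉0 0<x)))
    (0≤xy ⟨*⟩ ⁻¹-nonNeg 0<x)

  square-nonNeg : ∀ x → 0# ≤ x * x
  square-nonNeg x with total 0# x
  ... | inj₁ 0≤x = 0≤x ⟨*⟩ 0≤x
  ... | inj₂ x≤0 = ≤-respʳ-≈ (solve 1 (λ x → (:# 0 :- x) :* (:# 0 :- x) := x :* x) refl x)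
                     (≤⇒0≤ x≤0 ⟨*⟩ ≤⇒0≤ x≤0)

  square-cancel-≤ : ∀ {x y} → 0# ≤ y → x * x ≤ y * y → x ≤ y
  square-cancel-≤ {x} {y} 0≤y x²≤y² with em {x ≤ y}
  ... | yes x≤y = x≤y
  ... | no  x≰y = contradiction x²≤y² (<⇒≱ y²<x²)
    where
    y<x : y < x
    y<x = ≰⇒> x≰y
    0<x-y : 0# < x - y
    0<x-y = <⇒0<- y<x
    0<x+y : 0# < x + y
    0<x+y = <-≤-trans 0<x-y (≤-slack (0≤y ⟨+⟩ 0≤y)
      (solve 2 (λ x y → x :- y :+ (y :+ y) := x :+ y) refl x y))
    y²<x² : y * y < x * x
    y²<x² = 0<⇒< (x * x) (*-pos 0<x-y 0<x+y)
      (solve 2 (λ x y → y :* y :+ (x :- y) :* (x :+ y) := x :* x) refl x y)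

  square-injective : ∀ {x y} → 0# ≤ x → 0# ≤ y → x * x ≈ y * y → x ≈ y
  square-injective 0≤x 0≤y eq = ≤-antisym
    (square-cancel-≤ 0≤y (≤-reflexive eq)) (square-cancel-≤ 0≤x (≤-reflexive (sym eq)))

  -- Any r with r² = pq is allowed, so the lemma applies to multiples of `r σ` as well as to
  -- geometric means.
  am-gm : ∀ {p q r} → 0# ≤ p → 0# ≤ q → r * r ≈ p * q → # 2 * r ≤ p + q
  am-gm {p} {q} {r} 0≤p 0≤q r²≈pq = square-cancel-≤ (0≤p ⟨+⟩ 0≤q) (≤-slack (square-nonNeg (p - q)) (begin
    # 2 * r * (# 2 * r) + (p - q) * (p - q)
      ≈⟨ solve 3 (λ p q r → :# 2 :* r :* (:# 2 :* r) :+ (p :- q) :* (p :- q)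
                  := :# 4 :* (r :* r) :+ (p :- q) :* (p :- q)) refl p q r ⟩
    # 4 * (r * r) + (p - q) * (p - q)
      ≈⟨ +-congʳ (*-congˡ r²≈pq) ⟩
    # 4 * (p * q) + (p - q) * (p - q)
      ≈⟨ solve 2 (λ p q → :# 4 :* (p :* q) :+ (p :- q) :* (p :- q) := (p :+ q) :* (p :+ q)) refl p q ⟩
    (p + q) * (p + q) ∎))
    where open ≈-Reasoning setoid

  sqrt-nonNeg : ∀ x → 0# ≤ sqrt x
  sqrt-nonNeg x with complete (SqrtCut x) (0# , inj₁ refl) (sqrtCut-bounded x)
  ... | s , ub , _ = ub (inj₁ refl)

  abstract
    sqrt-square : ∀ {x} → 0# ≤ x → sqrt x * sqrt x ≈ x
    sqrt-square {x} 0≤x with complete (SqrtCut x) (0# , inj₁ refl) (sqrtCut-bounded x)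
    ... | s , ub , least = ≤-antisym s²≤x x≤s²
      where
      0≤s : 0# ≤ s
      0≤s = ub (inj₁ refl)
      0<2s+1 : 0# < # 2 * s + 1#
      0<2s+1 = <-≤-trans 0<1 (≤-slack (#-nonNeg 2 ⟨*⟩ 0≤s) (+-comm _ _))
      s²≤x : s * s ≤ x
      s²≤x with em {s * s ≤ x}
      ... | yes p = p
      ... | no  s²≰x = contradiction (least (s - h) s-h-ub) (<⇒≱ (x-ε<x s 0<h))
        where
        x<s² : x < s * s
        x<s² = ≰⇒> s²≰x
        d h : ℝ
        d = s * s - x
        -- With (2s + 1)h = d one gets (s - h)² = x + h² + h and (2s + 1)(s - h) = s² + s + x, so s
        -- - h is a smaller upper bound.
        h = d * (# 2 * s + 1#) ⁻¹
        0<d : 0# < d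
        0<d = <⇒0<- x<s²
        0<h : 0# < h
        0<h = *-pos 0<d (⁻¹-pos 0<2s+1)
        h-eq : (# 2 * s + 1#) * h ≈ d
        h-eq = *-÷-cancel (0<⇒≉0 0<2s+1)
        0≤s-h : 0# ≤ s - h
        0≤s-h = *-cancelˡ-≤0 0<2s+1 (≤-respʳ-≈ (begin
          s * s + s + x ≈⟨ solve 2 (λ s x → s :* s :+ s :+ x := (:# 2 :* s :+ :# 1) :* s :- (s :* s :- x)) refl s x ⟩
          (# 2 * s + 1#) * s - d ≈⟨ +-congˡ (-‿cong h-eq) ⟨
          (# 2 * s + 1#) * s - (# 2 * s + 1#) * h
            ≈⟨ solve 2 (λ s h → (:# 2 :* s :+ :# 1) :* s :- (:# 2 :* s :+ :# 1) :* h
                         := (:# 2 :* s :+ :# 1) :* (s :- h)) refl s h ⟩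
          (# 2 * s + 1#) * (s - h) ∎) (0≤s ⟨*⟩ 0≤s ⟨+⟩ 0≤s ⟨+⟩ 0≤x))
          where open ≈-Reasoning setoid
        x≤[s-h]² : x ≤ (s - h) * (s - h)
        x≤[s-h]² = ≤-slack (square-nonNeg h ⟨+⟩ <⇒≤ 0<h) (begin
          x + (h * h + h)     ≈⟨ solve 3 (λ x s h → x :+ (h :* h :+ h) := s :* s :- (s :* s :- x) :+ h :* h :+ h) refl x s h ⟩
          s * s - d + h * h + h  ≈⟨ +-congʳ (+-congʳ (+-congˡ (-‿cong h-eq))) ⟨
          s * s - (# 2 * s + 1#) * h + h * h + h
            ≈⟨ solve 2 (λ s h → s :* s :- (:# 2 :* s :+ :# 1) :* h :+ h :* h :+ h := (s :- h) :* (s :- h)) refl s h ⟩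
          (s - h) * (s - h) ∎)
          where open ≈-Reasoning setoid
        s-h-ub : ∀ {y} → SqrtCut x y → y ≤ s - h
        s-h-ub (inj₁ y≈0)  = ≤-respˡ-≈ (sym y≈0) 0≤s-h
        s-h-ub (inj₂ y²≤x) = square-cancel-≤ 0≤s-h (≤-trans y²≤x x≤[s-h]²)
      x≤s² : x ≤ s * s
      x≤s² with em {x ≤ s * s}
      ... | yes p = p
      ... | no  x≰s² = contradiction (ub (inj₂ [s+h]²≤x)) (<⇒≱ (0<⇒< (s + h) 0<h refl))
        where
        s²<x : s * s < x
        s²<x = ≰⇒> x≰s²
        d k h : ℝ
        d = x - s * s
        k = # 2 * s + 1# + d
        -- The summand d in k forces h ≤ 1, hence h² ≤ h and (s + h)² ≤ s² + (2s + 1)h ≤ x.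
        h = d * k ⁻¹
        0<d : 0# < d
        0<d = <⇒0<- s²<x
        0<k : 0# < k
        0<k = <-≤-trans 0<2s+1 (≤-slack (<⇒≤ 0<d) refl)
        0<h : 0# < h
        0<h = *-pos 0<d (⁻¹-pos 0<k)
        h-eq : k * h ≈ d
        h-eq = *-÷-cancel (0<⇒≉0 0<k)
        0≤1-h : 0# ≤ 1# - h
        0≤1-h = *-cancelˡ-≤0 0<k (≤-respʳ-≈ (begin
          # 2 * s + 1#   ≈⟨ solve 2 (λ s d → :# 2 :* s :+ :# 1 := (:# 2 :* s :+ :# 1 :+ d) :* :# 1 :- d) refl s d ⟩
          k * 1# - d     ≈⟨ +-congˡ (-‿cong h-eq) ⟨
          k * 1# - k * h ≈⟨ solve 2 (λ k h → k :* :# 1 :- k :* h := k :* (:# 1 :- h)) refl k h ⟩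
          k * (1# - h)   ∎) (<⇒≤ 0<2s+1))
          where open ≈-Reasoning setoid
        [s+h]²≤x : (s + h) * (s + h) ≤ x
        [s+h]²≤x = ≤-slack (<⇒≤ 0<d ⟨*⟩ <⇒≤ 0<h ⟨+⟩ <⇒≤ 0<h ⟨*⟩ 0≤1-h) (begin
          (s + h) * (s + h) + (d * h + h * (1# - h))
            ≈⟨ solve 3 (λ s h d → (s :+ h) :* (s :+ h) :+ (d :* h :+ h :* (:# 1 :- h))
                         := s :* s :+ (:# 2 :* s :+ :# 1 :+ d) :* h) refl s h d ⟩
          s * s + k * h       ≈⟨ +-congˡ h-eq ⟩
          s * s + (x - s * s) ≈⟨ solve 2 (λ x y → y :+ (x :- y) := x) refl x (s * s) ⟩
          x                   ∎)
          where open ≈-Reasoning setoid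

  abstract
    -- Stands in for the convergence of bounded increasing sequences: it supplies an index after
    -- which at most ε is still to come.
    bounded⇒almost-maximal : ∀ (s : ℕ → ℝ) b → (∀ n → s n ≤ b) → ∀ {ε} → 0# < ε →
                             ∃[ n ] ∀ m → s m ≤ s n + ε
    bounded⇒almost-maximal s b s≤b {ε} 0<ε
      with complete (λ x → ∃[ n ] x ≈ s n) (s 0 , 0 , refl) (b , λ (n , x≈sn) → ≤-respˡ-≈ (sym x≈sn) (s≤b n))
         | em {∃[ n ] ∀ m → s m ≤ s n + ε}
    ... | _               | yes p = p
    ... | c , ub , least  | no ¬p = contradiction (least (c - ε) c-ε-ub) (<⇒≱ (x-ε<x c 0<ε))
      where
      c-ε-ub : ∀ {x} → ∃[ n ] x ≈ s n → x ≤ c - ε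
      c-ε-ub {x} (n , x≈sn) with em {x ≤ c - ε}
      ... | yes p = p
      ... | no  x≰ = contradiction (n , λ m → ≤-trans (ub (m , refl)) (≤-slack (≤⇒0≤ (<⇒≤ (≰⇒> x≰)))
              (trans (solve 3 (λ c ε x → c :+ (x :- (c :- ε)) := x :+ ε) refl c ε x) (+-congʳ x≈sn)))) ¬p

-- Prefixes, codes of strings, open sets as sets of strings.

infix 4 _⊑_
_⊑_ : String → String → Set
τ ⊑ σ = take (length τ) σ ≡ τ

take-++ : ∀ (σ ρ : String) → take (length σ) (σ ++ ρ) ≡ σ
take-++ []      ρ = ≡.refl
take-++ (a ∷ σ) ρ = ≡.cong (a ∷_) (take-++ σ ρ)

take-take-≤ : ∀ {m n} (σ : String) → m ℕ.≤ n → take m (take n σ) ≡ take m σ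
take-take-≤ {m} {n} σ m≤n = ≡.trans (take-take m n σ) (≡.cong (λ k → take k σ) (ℕ.m≤n⇒m⊓n≡m m≤n))

take-++-≤ : ∀ k (σ ρ : String) → k ℕ.≤ length σ → take k (σ ++ ρ) ≡ take k σ
take-++-≤ k σ ρ k≤ = ≡.trans (≡.sym (take-take-≤ (σ ++ ρ) k≤)) (≡.cong (take k) (take-++ σ ρ))

take-↾ : ∀ ω {m n} → m ℕ.≤ n → take m (ω ↾ n) ≡ ω ↾ m
take-↾ ω z≤n       = ≡.refl
take-↾ ω (s≤s m≤n) = ≡.cong (ω 0 ∷_) (take-↾ (ω ∘ suc) m≤n)

length-∷ʳ : ∀ (σ : String) b → length (σ ∷ʳ b) ≡ suc (length σ)
length-∷ʳ σ b = ≡.trans (length-++ σ) (ℕ.+-comm (length σ) 1)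

[]⇒⊑ : ∀ {τ ω n} → [ τ ] ω → length τ ℕ.≤ n → τ ⊑ ω ↾ n
[]⇒⊑ {ω = ω} ω∈τ ≤n = ≡.trans (take-↾ ω ≤n) ω∈τ

⊑-++ : ∀ {τ σ} ρ → τ ⊑ σ → τ ⊑ σ ++ ρ
⊑-++ {τ} {σ} ρ τ⊑σ = ≡.trans (take-++-≤ (length τ) σ ρ |τ|≤|σ|) τ⊑σ
  where
  |τ|≤|σ| : length τ ℕ.≤ length σ
  |τ|≤|σ| = ≡.subst (ℕ._≤ length σ) (≡.trans (≡.sym (length-take (length τ) σ)) (≡.cong length τ⊑σ))
              (ℕ.m⊓n≤n (length τ) (length σ))

⊓-⊑ : ∀ τ σ → τ ⊑ σ → σ ⊓ τ ≡ just σ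
⊓-⊑ []          []          _  = ≡.refl
⊓-⊑ []          (_ ∷ _)     _  = ≡.refl
⊓-⊑ (false ∷ τ) (false ∷ σ) eq = ≡.cong (Maybe.map (false ∷_)) (⊓-⊑ τ σ (∷-injectiveʳ eq))
⊓-⊑ (true ∷ τ)  (true ∷ σ)  eq = ≡.cong (Maybe.map (true ∷_)) (⊓-⊑ τ σ (∷-injectiveʳ eq))
⊓-⊑ (false ∷ τ) (true ∷ σ)  ()
⊓-⊑ (true ∷ τ)  (false ∷ σ) ()
⊓-⊑ (_ ∷ _)     []          ()

⊓-dichotomy : ∀ τ σ → length τ ℕ.≤ length σ →
              σ ⊓ τ ≡ nothing ⊎ (σ ⊓ τ ≡ just σ × τ ⊑ σ)
⊓-dichotomy []          []          _        = inj₂ (≡.refl , ≡.refl)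
⊓-dichotomy []          (_ ∷ _)     _        = inj₂ (≡.refl , ≡.refl)
⊓-dichotomy (false ∷ τ) (true ∷ σ)  _        = inj₁ ≡.refl
⊓-dichotomy (true ∷ τ)  (false ∷ σ) _        = inj₁ ≡.refl
⊓-dichotomy (false ∷ τ) (false ∷ σ) (s≤s le) with ⊓-dichotomy τ σ le
... | inj₁ eq        = inj₁ (≡.cong (Maybe.map (false ∷_)) eq)
... | inj₂ (eq , le′) = inj₂ (≡.cong (Maybe.map (false ∷_)) eq , ≡.cong (false ∷_) le′)
⊓-dichotomy (true ∷ τ)  (true ∷ σ)  (s≤s le) with ⊓-dichotomy τ σ le
... | inj₁ eq        = inj₁ (≡.cong (Maybe.map (true ∷_)) eq)
... | inj₂ (eq , le′) = inj₂ (≡.cong (Maybe.map (true ∷_)) eq , ≡.cong (true ∷_) le′)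

-- In a family indexed by codes, the members with index below n have length below n and so can be
-- measured at level n.
length≤⌜⌝ : ∀ σ → length σ ℕ.≤ ⌜ σ ⌝
length≤⌜⌝ []          = z≤n
length≤⌜⌝ (false ∷ σ) = s≤s (ℕ.≤-trans (length≤⌜⌝ σ) (ℕ.m≤m+n _ _))
length≤⌜⌝ (true ∷ σ)  = s≤s (ℕ.≤-trans (length≤⌜⌝ σ) (ℕ.≤-trans (ℕ.m≤m+n _ _) (ℕ.n≤1+n _)))

⌜⌝-injective : ∀ σ τ → ⌜ σ ⌝ ≡ ⌜ τ ⌝ → σ ≡ τ
⌜⌝-injective []          []          _  = ≡.refl
⌜⌝-injective (false ∷ σ) (false ∷ τ) eq =
  ≡.cong (false ∷_) (⌜⌝-injective σ τ (ℕ.*-cancelˡ-≡ _ _ 2 (ℕ.suc-injective eq)))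
⌜⌝-injective (true ∷ σ)  (true ∷ τ)  eq =
  ≡.cong (true ∷_) (⌜⌝-injective σ τ (ℕ.*-cancelˡ-≡ _ _ 2 (ℕ.suc-injective (ℕ.suc-injective eq))))
⌜⌝-injective (false ∷ σ) (true ∷ τ)  eq =
  contradiction (ℕ.suc-injective eq) (ℕ.even≢odd ⌜ σ ⌝ ⌜ τ ⌝)
⌜⌝-injective (true ∷ σ)  (false ∷ τ) eq =
  contradiction (≡.sym (ℕ.suc-injective eq)) (ℕ.even≢odd ⌜ τ ⌝ ⌜ σ ⌝)
⌜⌝-injective []          (false ∷ τ) ()
⌜⌝-injective []          (true ∷ τ)  ()
⌜⌝-injective (false ∷ σ) []          ()
⌜⌝-injective (true ∷ σ)  []          ()

-- Such a P stands for the open set of all ω with some prefix in P.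
ExtensionClosed : Pred String 0ℓ → Set
ExtensionClosed P = ∀ σ ρ → P σ → P (σ ++ ρ)

-- The minimal strings are prefix-free and generate the same open set, so they cover it by disjoint
-- cylinders.
Minimal : Pred String 0ℓ → Pred String 0ℓ
Minimal P σ = P σ × (∀ k → k ℕ.< length σ → ¬ P (take k σ))

minimal-≮ : ∀ {P σ₁ σ₂} σ → Minimal P σ₁ → Minimal P σ₂ → σ₁ ⊑ σ → σ₂ ⊑ σ → ¬ length σ₁ ℕ.< length σ₂
minimal-≮ {P} {σ₁} {σ₂} σ (p₁ , _) (_ , min₂) ⊑₁ ⊑₂ lt = min₂ _ lt (≡.subst P σ₁≡ p₁)
  where
  σ₁≡ : σ₁ ≡ take (length σ₁) σ₂
  σ₁≡ = ≡.trans (≡.sym ⊑₁) (≡.trans (≡.sym (take-take-≤ σ (ℕ.<⇒≤ lt))) (≡.cong (take _) ⊑₂))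

minimal-unique : ∀ {P σ₁ σ₂} σ → Minimal P σ₁ → Minimal P σ₂ → σ₁ ⊑ σ → σ₂ ⊑ σ → σ₁ ≡ σ₂
minimal-unique {σ₁ = σ₁} {σ₂} σ min₁ min₂ ⊑₁ ⊑₂ with ℕ.<-cmp (length σ₁) (length σ₂)
... | tri< lt _ _ = contradiction lt (minimal-≮ σ min₁ min₂ ⊑₁ ⊑₂)
... | tri≈ _ eq _ = ≡.trans (≡.sym ⊑₁) (≡.trans (≡.cong (λ k → take k σ) eq) ⊑₂)
... | tri> _ _ gt = contradiction gt (minimal-≮ σ min₂ min₁ ⊑₂ ⊑₁)

Extends : Maybe String → Pred String 0ℓ
Extends c σ = ∃[ τ ] c ≡ just τ × τ ⊑ σ

-- The strings extending one of the cylinders C i; the bound on i makes the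
-- set at each level a finite union and does not change the open set.
Covered : (ℕ → Maybe String) → Pred String 0ℓ
Covered C σ = ∃[ i ] i ℕ.< length σ × Extends (C i) σ

Covered-extensionClosed : ∀ C → ExtensionClosed (Covered C)
Covered-extensionClosed C σ ρ (i , i<|σ| , τ , eq , τ⊑σ) =
  i , ℕ.<-≤-trans i<|σ| (≡.subst (length σ ℕ.≤_) (≡.sym (length-++ σ)) (ℕ.m≤m+n _ _))
    , τ , eq , ⊑-++ {τ} ρ τ⊑σ

-- Sums over the strings of one length; measuring open sets.

module LevelSums (em : ExcludedMiddle 0ℓ) (R : CompleteOrderedField) where
  open CompleteOrderedField R hiding (zero)
  open OverReals R
  open IntegerRingSolver R
  open OrderedFieldProperties em R

  ∑-mono : ∀ n {f g} → (∀ i → i ℕ.< n → f i ≤ g i) → ∑[ n ] f ≤ ∑[ n ] g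
  ∑-mono zero    f≤g = ≤-refl
  ∑-mono (suc n) f≤g = +-mono-≤ (∑-mono n (λ i i<n → f≤g i (ℕ.m<n⇒m<1+n i<n))) (f≤g n ℕ.≤-refl)

  ∑-nonNeg : ∀ n {f} → (∀ i → 0# ≤ f i) → 0# ≤ ∑[ n ] f
  ∑-nonNeg zero    0≤f = ≤-refl
  ∑-nonNeg (suc n) 0≤f = ∑-nonNeg n 0≤f ⟨+⟩ 0≤f n

  ∑-term : ∀ n {f} → (∀ i → 0# ≤ f i) → ∀ {i} → i ℕ.< n → f i ≤ ∑[ n ] f
  ∑-term (suc n) {f} 0≤f {i} i<1+n with ℕ.m≤n⇒m<n∨m≡n (ℕ.s≤s⁻¹ i<1+n)
  ... | inj₁ i<n    = ≤-trans (∑-term n 0≤f i<n) (≤-slack (0≤f n) refl)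
  ... | inj₂ ≡.refl = ≤-slack (∑-nonNeg n 0≤f) (+-comm _ _)

  -- Branches by appending a bit at the node σ, whereas `∑-strings` branches on the first bit; this
  -- matches `additive` and recursion down the tree.
  ∑ext : ℕ → String → (String → ℝ) → ℝ
  ∑ext zero    σ f = f σ
  ∑ext (suc m) σ f = ∑ext m (σ ∷ʳ false) f + ∑ext m (σ ∷ʳ true) f

  ∑ext-mono : ∀ m σ {f g} → (∀ ρ → length ρ ≡ m → f (σ ++ ρ) ≤ g (σ ++ ρ)) → ∑ext m σ f ≤ ∑ext m σ g
  ∑ext-mono zero    σ {f} {g} f≤g = ≡.subst (λ τ → f τ ≤ g τ) (++-identityʳ σ) (f≤g [] ≡.refl)
  ∑ext-mono (suc m) σ {f} {g} f≤g = +-mono-≤ (branch false) (branch true)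
    where
    branch : ∀ b → ∑ext m (σ ∷ʳ b) f ≤ ∑ext m (σ ∷ʳ b) g
    branch b = ∑ext-mono m (σ ∷ʳ b) λ ρ eq →
      ≡.subst (λ τ → f τ ≤ g τ) (≡.sym (∷ʳ-++ σ b ρ)) (f≤g (b ∷ ρ) (≡.cong suc eq))

  ∑ext-cong : ∀ m σ {f g} → (∀ ρ → length ρ ≡ m → f (σ ++ ρ) ≈ g (σ ++ ρ)) → ∑ext m σ f ≈ ∑ext m σ g
  ∑ext-cong m σ f≈g = ≤-antisym (∑ext-mono m σ λ ρ eq → ≤-reflexive (f≈g ρ eq))
                             (∑ext-mono m σ λ ρ eq → ≤-reflexive (sym (f≈g ρ eq)))

  ∑ext-+ : ∀ m σ f g → ∑ext m σ (λ τ → f τ + g τ) ≈ ∑ext m σ f + ∑ext m σ g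
  ∑ext-+ zero    σ f g = refl
  ∑ext-+ (suc m) σ f g = trans (+-cong (∑ext-+ m _ f g) (∑ext-+ m _ f g))
    (solve 4 (λ a b c d → a :+ b :+ (c :+ d) := a :+ c :+ (b :+ d)) refl _ _ _ _)

  ∑ext-* : ∀ m σ c f → ∑ext m σ (λ τ → c * f τ) ≈ c * ∑ext m σ f
  ∑ext-* zero    σ c f = refl
  ∑ext-* (suc m) σ c f = trans (+-cong (∑ext-* m _ c f) (∑ext-* m _ c f)) (sym (distribˡ _ _ _))

  ∑ext-0 : ∀ m σ → ∑ext m σ (λ _ → 0#) ≈ 0#
  ∑ext-0 zero    σ = refl
  ∑ext-0 (suc m) σ = trans (+-cong (∑ext-0 m _) (∑ext-0 m _)) (+-identityˡ 0#)

  ∑ext-nonNeg : ∀ m σ {f} → (∀ τ → 0# ≤ f τ) → 0# ≤ ∑ext m σ f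
  ∑ext-nonNeg m σ 0≤f = ≤-respˡ-≈ (∑ext-0 m σ) (∑ext-mono m σ (λ ρ _ → 0≤f _))

  ∑ext-∑ : ∀ m σ n (f : ℕ → String → ℝ) → ∑ext m σ (λ τ → ∑[ n ] (λ i → f i τ)) ≈ ∑[ n ] (λ i → ∑ext m σ (f i))
  ∑ext-∑ m σ zero    f = ∑ext-0 m σ
  ∑ext-∑ m σ (suc n) f = trans (∑ext-+ m σ _ _) (+-congʳ (∑ext-∑ m σ n f))

  ∑ext-split : ∀ n k σ f → ∑ext (n ℕ.+ k) σ f ≈ ∑ext n σ (λ τ → ∑ext k τ f)
  ∑ext-split zero    k σ f = refl
  ∑ext-split (suc n) k σ f = +-cong (∑ext-split n k _ f) (∑ext-split n k _ f)

  Additive : Pred (String → ℝ) 0ℓ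
  Additive f = ∀ σ → f σ ≈ f (σ ∷ʳ false) + f (σ ∷ʳ true)

  ∑ext-additive : ∀ m σ {f} → Additive f → ∑ext m σ f ≈ f σ
  ∑ext-additive zero    σ add = refl
  ∑ext-additive (suc m) σ add = trans (+-cong (∑ext-additive m _ add) (∑ext-additive m _ add)) (sym (add σ))

  restrict : Pred String 0ℓ → (String → ℝ) → String → ℝ
  restrict P f σ with em {P σ}
  ... | yes _ = f σ
  ... | no  _ = 0#

  restrict-∈ : ∀ {P} f {σ} → P σ → restrict P f σ ≡ f σ
  restrict-∈ {P} f {σ} p with em {P σ}
  ... | yes _ = ≡.refl
  ... | no ¬p = contradiction p ¬p

  restrict-∉ : ∀ {P} f {σ} → ¬ P σ → restrict P f σ ≡ 0#
  restrict-∉ {P} f {σ} ¬p with em {P σ}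
  ... | yes p = contradiction p ¬p
  ... | no _  = ≡.refl

  restrict-nonNeg : ∀ P {f} → (∀ σ → 0# ≤ f σ) → ∀ σ → 0# ≤ restrict P f σ
  restrict-nonNeg P 0≤f σ with em {P σ}
  ... | yes _ = 0≤f σ
  ... | no _  = ≤-refl

  restrict-≤ : ∀ P {f} → (∀ σ → 0# ≤ f σ) → ∀ σ → restrict P f σ ≤ f σ
  restrict-≤ P 0≤f σ with em {P σ}
  ... | yes _ = ≤-refl
  ... | no _  = 0≤f σ

  restrict-mono : ∀ P Q {f} → (∀ σ → 0# ≤ f σ) → ∀ σ → (P σ → Q σ) → restrict P f σ ≤ restrict Q f σ
  restrict-mono P Q {f} 0≤f σ P⇒Q with em {P σ}
  ... | yes p = ≤-reflexive (reflexive (≡.sym (restrict-∈ f (P⇒Q p))))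
  ... | no _  = restrict-nonNeg Q 0≤f σ

  restrict-≤-intro : ∀ P f σ {b} → 0# ≤ b → (P σ → f σ ≤ b) → restrict P f σ ≤ b
  restrict-≤-intro P f σ 0≤b f≤b with em {P σ}
  ... | yes p = f≤b p
  ... | no _  = 0≤b

  restrict-⊎ : ∀ P Q S {f} → (∀ σ → 0# ≤ f σ) → ∀ σ → (P σ → Q σ ⊎ S σ) →
               restrict P f σ ≤ restrict Q f σ + restrict S f σ
  restrict-⊎ P Q S {f} 0≤f σ P⇒ with em {P σ}
  ... | no _ = restrict-nonNeg Q 0≤f σ ⟨+⟩ restrict-nonNeg S 0≤f σ
  ... | yes p with P⇒ p
  ...   | inj₁ q = ≤-slack (restrict-nonNeg S 0≤f σ) (+-congʳ (reflexive (≡.sym (restrict-∈ f q))))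
  ...   | inj₂ s = ≤-slack (restrict-nonNeg Q 0≤f σ)
                     (trans (+-comm _ _) (+-congˡ (reflexive (≡.sym (restrict-∈ f s)))))

  Covered-covers : ∀ {ℓ} {A : Pred Cantor ℓ} {C} → Covers C A → ∀ {ω} → A ω → ∃[ k ] Covered C (ω ↾ k)
  Covered-covers {C = C} covers {ω} a = let n , τ , eq , ω∈τ = covers a
                                            -- Longer than the index n, as `Covered` demands, and at
                                            -- least as long as τ.
                                            k = suc n ℕ.+ length τ in
    k , n , ≡.subst (n ℕ.<_) (≡.sym (length-applyUpTo ω k)) (ℕ.m≤m+n (suc n) (length τ)) ,
    τ , eq , []⇒⊑ {τ} {ω} ω∈τ (ℕ.m≤n+m (length τ) (suc n))

  module _ (ν : Measure) where
    -- ν of the open set given, at precision m, by the strings of length m in P.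
    level : ℕ → Pred String 0ℓ → ℝ
    level m P = ∑ext m [] (restrict P (mass ν))

    level-take : ∀ n k P → level (n ℕ.+ k) (P ∘ take n) ≈ level n P
    level-take n k P = trans (∑ext-split n k [] _) (∑ext-cong n [] node)
      where
      node : ∀ τ → length τ ≡ n → ∑ext k τ (restrict (P ∘ take n) (mass ν)) ≈ restrict P (mass ν) τ
      node τ ≡.refl with em {P τ}
      ... | yes p = trans
        (∑ext-cong k τ λ ρ _ → reflexive (restrict-∈ (mass ν) (≡.subst P (≡.sym (take-++ τ ρ)) p)))
        (∑ext-additive k τ (additive ν))
      ... | no ¬p = trans
        (∑ext-cong k τ λ ρ _ → reflexive (restrict-∉ (mass ν) (¬p ∘ ≡.subst P (take-++ τ ρ))))
        (∑ext-0 k τ)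

    level-mono : ∀ m P Q → (∀ σ → length σ ≡ m → P σ → Q σ) → level m P ≤ level m Q
    level-mono m P Q P⊆Q = ∑ext-mono m [] λ ρ eq → restrict-mono P Q (nonNeg ν) ρ (P⊆Q ρ eq)

    -- Level sums approximate an open set from below: strings already in P keep all their
    -- extensions, and longer strings may join.
    level-≤-+ : ∀ {P} → ExtensionClosed P → ∀ n k → level n P ≤ level (n ℕ.+ k) P
    level-≤-+ {P} ext n k = ≤-respˡ-≈ (level-take n k P)
      (level-mono (n ℕ.+ k) (P ∘ take n) P λ σ _ p →
        ≡.subst P (take++drop≡id n σ) (ext (take n σ) (drop n σ) p))

    level-≤-1 : ∀ m P → level m P ≤ 1#
    level-≤-1 m P = ≤-respʳ-≈ (trans (∑ext-additive m [] (additive ν)) (mass-[] ν))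
      (∑ext-mono m [] λ ρ _ → restrict-≤ P (nonNeg ν) ρ)

    meet-additive : ∀ τ → Additive (λ σ → mass? (mass ν) (σ ⊓ τ))
    meet-additive τ σ = mass?-⊓-additive (mass ν) (additive ν) σ τ

    -- By additivity the masses of [σ] ∩ [τ] over any level sum to ν τ, and an extension of τ
    -- contributes its whole mass to that sum.
    level-Extends-≤ : ∀ m c → level m (Extends c) ≤ mass? (mass ν) c
    level-Extends-≤ m nothing  = ≤-reflexive (trans
      (∑ext-cong m [] λ ρ _ → reflexive (restrict-∉ (mass ν) λ ())) (∑ext-0 m []))
    level-Extends-≤ m (just τ) = ≤-respʳ-≈ (∑ext-additive m [] (meet-additive τ)) (∑ext-mono m [] λ ρ _ → leaf ρ)
      where
      leaf : ∀ σ → restrict (Extends (just τ)) (mass ν) σ ≤ mass? (mass ν) (σ ⊓ τ)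
      leaf σ with em {Extends (just τ) σ}
      ... | yes (_ , ≡.refl , τ⊑σ) = ≤-reflexive (reflexive (≡.sym (≡.cong (mass? (mass ν)) (⊓-⊑ τ σ τ⊑σ))))
      ... | no _ = mass?-nonNeg (mass ν) (nonNeg ν) (σ ⊓ τ)

    -- The length bound rules out proper prefixes σ of τ, which meet [τ] without extending τ.
    ≤-level-Extends : ∀ m {c} → (∀ {τ} → c ≡ just τ → length τ ℕ.≤ m) →
                      mass? (mass ν) c ≤ level m (Extends c)
    ≤-level-Extends m {nothing} _ = ∑ext-nonNeg m [] (restrict-nonNeg (Extends nothing) (nonNeg ν))
    ≤-level-Extends m {just τ} |τ|≤m = ≤-respˡ-≈ (∑ext-additive m [] (meet-additive τ))
      (∑ext-mono m [] λ ρ eq → leaf ρ (≡.subst (length τ ℕ.≤_) (≡.sym eq) (|τ|≤m ≡.refl)))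
      where
      leaf : ∀ σ → length τ ℕ.≤ length σ → mass? (mass ν) (σ ⊓ τ) ≤ restrict (Extends (just τ)) (mass ν) σ
      leaf σ le with ⊓-dichotomy τ σ le
      ... | inj₁ eq = ≤-respˡ-≈ (reflexive (≡.sym (≡.cong (mass? (mass ν)) eq)))
                        (restrict-nonNeg (Extends (just τ)) (nonNeg ν) σ)
      ... | inj₂ (eq , τ⊑σ) = ≤-reflexive (reflexive (≡.trans (≡.cong (mass? (mass ν)) eq)
                        (≡.sym (restrict-∈ (mass ν) (τ , ≡.refl , τ⊑σ)))))

    restrict-Covered-≤ : ∀ C σ → restrict (Covered C) (mass ν) σ ≤
                          ∑[ length σ ] (λ i → restrict (Extends (C i)) (mass ν) σ)
    restrict-Covered-≤ C σ with em {Covered C σ}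
    ... | no _ = ∑-nonNeg (length σ) λ i → restrict-nonNeg (Extends (C i)) (nonNeg ν) σ
    ... | yes (i , i<|σ| , ext) = ≤-trans (≤-reflexive (reflexive (≡.sym (restrict-∈ (mass ν) ext))))
      (∑-term (length σ) (λ i → restrict-nonNeg (Extends (C i)) (nonNeg ν) σ) i<|σ|)

    level-Covered-≤ : ∀ C m → level m (Covered C) ≤ ∑[ m ] (mass? (mass ν) ∘ C)
    level-Covered-≤ C m = ≤-trans
      (∑ext-mono m [] λ ρ eq → ≡.subst (λ k → _ ≤ ∑[ k ] _) eq (restrict-Covered-≤ C ρ))
      (≤-trans (≤-reflexive (∑ext-∑ m [] m _)) (∑-mono m λ i _ → level-Extends-≤ m (C i)))

    module MinimalCover (P : Pred String 0ℓ) where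
      -- Placing each minimal string at its own code makes distinct indices carry disjoint
      -- cylinders; this is what bounds the sum of their masses by the measure of the open set.
      cover : ℕ → Maybe String
      cover n with em {∃[ σ ] ⌜ σ ⌝ ≡ n × Minimal P σ}
      ... | yes (σ , _) = just σ
      ... | no _        = nothing

      cover-just : ∀ {n σ} → cover n ≡ just σ → ⌜ σ ⌝ ≡ n × Minimal P σ
      cover-just {n} eq with em {∃[ σ ] ⌜ σ ⌝ ≡ n × Minimal P σ}
      cover-just ≡.refl | yes (σ , p) = p
      cover-just ()     | no _

      cover-⌜⌝ : ∀ {σ} → Minimal P σ → cover ⌜ σ ⌝ ≡ just σ
      cover-⌜⌝ {σ} min with em {∃[ τ ] ⌜ τ ⌝ ≡ ⌜ σ ⌝ × Minimal P τ}
      ... | yes (τ , eq , _) = ≡.cong just (⌜⌝-injective τ σ eq)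
      ... | no ¬p            = contradiction (σ , ≡.refl , min) ¬p

      cover-disjoint : ∀ {i j σ} → Extends (cover i) σ → Extends (cover j) σ → i ≡ j
      cover-disjoint {σ = σ} (τ₁ , eq₁ , ⊑₁) (τ₂ , eq₂ , ⊑₂) with cover-just eq₁ | cover-just eq₂
      ... | code₁ , min₁ | code₂ , min₂ =
        ≡.trans (≡.sym code₁) (≡.trans (≡.cong ⌜_⌝ (minimal-unique σ min₁ min₂ ⊑₁ ⊑₂)) code₂)

      ∃-minimal : ∀ ω n → P (ω ↾ n) → ∃[ k ] Minimal P (ω ↾ k)
      ∃-minimal ω = <-rec _ λ n rec p → step n rec p
        where
        step : ∀ n → (∀ {k} → k ℕ.< n → P (ω ↾ k) → ∃[ k ] Minimal P (ω ↾ k)) →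
               P (ω ↾ n) → ∃[ k ] Minimal P (ω ↾ k)
        step n rec p with em {∃[ k ] k ℕ.< n × P (ω ↾ k)}
        ... | yes (k , k<n , q) = rec k<n q
        ... | no ¬q = n , p , λ k k<|ω↾n| q →
          let k<n = ≡.subst (k ℕ.<_) (length-applyUpTo ω n) k<|ω↾n| in
          ¬q (k , k<n , ≡.subst P (take-↾ ω (ℕ.<⇒≤ k<n)) q)

      covers : Covers cover (λ ω → ∃[ n ] P (ω ↾ n))
      covers {ω} (n , p) with ∃-minimal ω n p
      ... | k , min = ⌜ ω ↾ k ⌝ , ω ↾ k , cover-⌜⌝ min , ≡.cong (ω ↾_) (length-applyUpTo ω k)

      module _ (ext : ExtensionClosed P) where
        extends⇒P : ∀ {i σ} → Extends (cover i) σ → P σ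
        extends⇒P {σ = σ} (τ , eq , τ⊑σ) = ≡.subst P
          (≡.trans (≡.cong (_++ drop (length τ) σ) (≡.sym τ⊑σ)) (take++drop≡id (length τ) σ))
          (ext τ _ (proj₁ (proj₂ (cover-just eq))))

        -- At most one term is nonzero, by `cover-disjoint`: if σ extends member n, all earlier
        -- terms vanish.
        disjoint-sum : ∀ n σ → ∑[ n ] (λ i → restrict (Extends (cover i)) (mass ν) σ) ≤ restrict P (mass ν) σ
        disjoint-sum zero    σ = restrict-nonNeg P (nonNeg ν) σ
        disjoint-sum (suc n) σ with em {Extends (cover n) σ}
        ... | no _ = ≤-respˡ-≈ (sym (+-identityʳ _)) (disjoint-sum n σ)
        ... | yes e = ≤-reflexive (trans (+-congʳ (∑-0 n ℕ.≤-refl))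
                       (trans (+-identityˡ _) (reflexive (≡.sym (restrict-∈ (mass ν) (extends⇒P e))))))
          where
          ∑-0 : ∀ k → k ℕ.≤ n → ∑[ k ] (λ i → restrict (Extends (cover i)) (mass ν) σ) ≈ 0#
          ∑-0 zero    _   = refl
          ∑-0 (suc k) k<n = trans (+-cong (∑-0 k (ℕ.<⇒≤ k<n))
            (reflexive (restrict-∉ (mass ν) λ e′ → ℕ.<⇒≢ k<n (cover-disjoint e′ e)))) (+-identityˡ 0#)

        ∑-cover-≤ : ∀ n → ∑[ n ] (mass? (mass ν) ∘ cover) ≤ level n P
        ∑-cover-≤ n = ≤-trans
          (∑-mono n λ i i<n → ≤-level-Extends n λ {τ} eq →
            ℕ.≤-trans (length≤⌜⌝ τ) (ℕ.≤-trans (ℕ.≤-reflexive (proj₁ (cover-just eq))) (ℕ.<⇒≤ i<n)))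
          (≤-trans (≤-reflexive (sym (∑ext-∑ n [] n _))) (∑ext-mono n [] λ ρ _ → disjoint-sum n ρ))

    -- Reduces nullity to bounds on finite level sums; the cover demanded by `Null` consists of the
    -- minimal strings.
    Null-from-open : ∀ {ℓ} {A : Pred Cantor ℓ} →
      (∀ ε → 0# < ε → ∃[ P ] ExtensionClosed P × (∀ {ω} → A ω → ∃[ n ] P (ω ↾ n)) × (∀ m → level m P ≤ ε)) →
      Null ν A
    Null-from-open h ε 0<ε with h ε 0<ε
    ... | P , ext , A⊆P , P≤ε = cover , covers ∘ A⊆P , λ n → ≤-trans (∑-cover-≤ ext n) (P≤ε n)
      where open MinimalCover P

-- Hellinger affinity and comparison of ν with multiples of μ.

module Affinity (em : ExcludedMiddle 0ℓ) (R : CompleteOrderedField) where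
  open CompleteOrderedField R hiding (zero)
  open OverReals R
  open IntegerRingSolver R
  open OrderedFieldProperties em R
  open LevelSums em R

  ∑-cong : ∀ n {f g} → (∀ i → i ℕ.< n → f i ≈ g i) → ∑[ n ] f ≈ ∑[ n ] g
  ∑-cong n f≈g = ≤-antisym (∑-mono n λ i i<n → ≤-reflexive (f≈g i i<n))
                           (∑-mono n λ i i<n → ≤-reflexive (sym (f≈g i i<n)))

  ∑-strings-0 : ∀ m {f} → (∀ σ → f σ ≈ 0#) → ∑-strings m f ≈ 0#
  ∑-strings-0 zero    f≈0 = f≈0 []
  ∑-strings-0 (suc m) f≈0 = trans
    (+-cong (∑-strings-0 m (f≈0 ∘ (false ∷_))) (∑-strings-0 m (f≈0 ∘ (true ∷_)))) (+-identityˡ 0#)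

  -- Among the strings one bit longer than τ only its two children meet [τ]. This collapses the
  -- expectation in the Hellinger distance to two terms.
  ∑-strings-meet : ∀ τ (φ : Maybe String → ℝ) → φ nothing ≈ 0# →
    ∑-strings (suc (length τ)) (λ σ → φ (σ ⊓ τ)) ≈ φ (just (τ ∷ʳ false)) + φ (just (τ ∷ʳ true))
  ∑-strings-meet []          φ φ∅ = refl
  ∑-strings-meet (false ∷ τ) φ φ∅ = trans
    (+-cong (∑-strings-meet τ (φ ∘ Maybe.map (false ∷_)) φ∅) (∑-strings-0 (suc (length τ)) (λ _ → φ∅)))
    (+-identityʳ _)
  ∑-strings-meet (true ∷ τ)  φ φ∅ = trans
    (+-cong (∑-strings-0 (suc (length τ)) (λ _ → φ∅)) (∑-strings-meet τ (φ ∘ Maybe.map (true ∷_)) φ∅))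
    (+-identityˡ _)

  -- For p ≥ 0 and q > 0 this is √(pq), in the form of a summand of 𝔼_Q[(dP/dQ)^½].
  geometricMean : ℝ → ℝ → ℝ
  geometricMean p q = q * sqrt (p ÷ q)

  geometricMean-nonNeg : ∀ p {q} → 0# ≤ q → 0# ≤ geometricMean p q
  geometricMean-nonNeg p 0≤q = 0≤q ⟨*⟩ sqrt-nonNeg _

  geometricMean-square : ∀ {p q} → 0# ≤ p → 0# < q → geometricMean p q * geometricMean p q ≈ p * q
  geometricMean-square {p} {q} 0≤p 0<q = begin
    q * sqrt (p ÷ q) * (q * sqrt (p ÷ q))
      ≈⟨ solve 2 (λ q s → q :* s :* (q :* s) := q :* (q :* (s :* s))) refl q (sqrt (p ÷ q)) ⟩
    q * (q * (sqrt (p ÷ q) * sqrt (p ÷ q)))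
      ≈⟨ *-congˡ (*-congˡ (sqrt-square (0≤p ⟨*⟩ ⁻¹-nonNeg 0<q))) ⟩
    q * (q * (p ÷ q))   ≈⟨ *-congˡ (*-÷-cancel (0<⇒≉0 0<q)) ⟩
    q * p               ≈⟨ *-comm q p ⟩
    p * q               ∎
    where open ≈-Reasoning setoid

  module _ (ν μ : Measure) (suppν : FullSupport ν) (suppμ : FullSupport μ) where
    private
      p q : String → Bool → ℝ
      p τ b = mass ν (τ ∷ʳ b) ÷ mass ν τ
      q τ b = mass μ (τ ∷ʳ b) ÷ mass μ τ

    r : String → ℝ
    r σ = sqrt (mass ν σ * mass μ σ)

    r-nonNeg : ∀ σ → 0# ≤ r σ
    r-nonNeg σ = sqrt-nonNeg _

    r-square : ∀ σ → r σ * r σ ≈ mass ν σ * mass μ σ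
    r-square σ = sqrt-square (nonNeg ν σ ⟨*⟩ nonNeg μ σ)

    affinity : String → ℝ
    affinity τ = geometricMean (p τ false) (q τ false) + geometricMean (p τ true) (q τ true)

    x : String → ℝ
    x τ = 1# - affinity τ

    private
      0≤p : ∀ τ b → 0# ≤ p τ b
      0≤p τ b = nonNeg ν _ ⟨*⟩ ⁻¹-nonNeg (suppν τ)

      0<q : ∀ τ b → 0# < q τ b
      0<q τ b = *-pos (suppμ _) (⁻¹-pos (suppμ τ))

      ÷-sum : ∀ (ρ : Measure) → FullSupport ρ → ∀ τ →
              mass ρ (τ ∷ʳ false) ÷ mass ρ τ + mass ρ (τ ∷ʳ true) ÷ mass ρ τ ≈ 1#
      ÷-sum ρ supp τ = trans (sym (distribʳ _ _ _))
        (trans (*-congʳ (sym (additive ρ τ))) (⁻¹-inverseʳ (0<⇒≉0 (supp τ))))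

    -- AM-GM for each bit; the four conditional probabilities add up to 2.
    x-nonNeg : ∀ τ → 0# ≤ x τ
    x-nonNeg τ = *-cancelˡ-≤0 (#-pos 1) (≤-respʳ-≈ (begin
        p₀ + q₀ - # 2 * g₀ + (p₁ + q₁ - # 2 * g₁)
          ≈⟨ solve 6 (λ a b c d e f → a :+ b :- :# 2 :* e :+ (c :+ d :- :# 2 :* f)
                       := (a :+ c) :+ (b :+ d) :- :# 2 :* (e :+ f)) refl p₀ q₀ p₁ q₁ g₀ g₁ ⟩
        (p₀ + p₁) + (q₀ + q₁) - # 2 * (g₀ + g₁)
          ≈⟨ +-congʳ (+-cong (÷-sum ν suppν τ) (÷-sum μ suppμ τ)) ⟩
        1# + 1# - # 2 * (g₀ + g₁)
          ≈⟨ solve 1 (λ a → :# 1 :+ :# 1 :- :# 2 :* a := :# 2 :* (:# 1 :- a)) refl (g₀ + g₁) ⟩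
        # 2 * x τ ∎)
      (≤⇒0≤ (half false) ⟨+⟩ ≤⇒0≤ (half true)))
      where
      open ≈-Reasoning setoid
      p₀ = p τ false ; p₁ = p τ true ; q₀ = q τ false ; q₁ = q τ true
      g₀ = geometricMean p₀ q₀ ; g₁ = geometricMean p₁ q₁
      half : ∀ b → # 2 * geometricMean (p τ b) (q τ b) ≤ p τ b + q τ b
      half b = am-gm (0≤p τ b) (<⇒≤ (0<q τ b)) (geometricMean-square (0≤p τ b) (0<q τ b))

    geometricMean-r : ∀ τ b → geometricMean (p τ b) (q τ b) * r τ ≈ r (τ ∷ʳ b)
    geometricMean-r τ b = square-injective 0≤gr (r-nonNeg _) (begin
      g * r τ * (g * r τ)       ≈⟨ solve 2 (λ g s → g :* s :* (g :* s) := g :* g :* (s :* s)) refl g (r τ) ⟩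
      g * g * (r τ * r τ)       ≈⟨ *-cong (geometricMean-square (0≤p τ b) (0<q τ b)) (r-square τ) ⟩
      p τ b * q τ b * (mass ν τ * mass μ τ)
        ≈⟨ solve 4 (λ a b c d → a :* b :* (c :* d) := c :* a :* (d :* b)) refl (p τ b) (q τ b) (mass ν τ) (mass μ τ) ⟩
      mass ν τ * p τ b * (mass μ τ * q τ b)
        ≈⟨ *-cong (*-÷-cancel (0<⇒≉0 (suppν τ))) (*-÷-cancel (0<⇒≉0 (suppμ τ))) ⟩
      mass ν (τ ∷ʳ b) * mass μ (τ ∷ʳ b)  ≈⟨ r-square _ ⟨
      r (τ ∷ʳ b) * r (τ ∷ʳ b) ∎)
      where
      open ≈-Reasoning setoid
      g = geometricMean (p τ b) (q τ b)
      0≤gr : 0# ≤ g * r τ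
      0≤gr = geometricMean-nonNeg _ (<⇒≤ (0<q τ b)) ⟨*⟩ r-nonNeg τ

    r-step : ∀ τ → r (τ ∷ʳ false) + r (τ ∷ʳ true) ≈ (1# - x τ) * r τ
    r-step τ = sym (trans
      (solve 3 (λ a b s → (:# 1 :- (:# 1 :- (a :+ b))) :* s := a :* s :+ b :* s) refl _ _ (r τ))
      (+-cong (geometricMean-r τ false) (geometricMean-r τ true)))

    hellinger-square : ∀ τ → let h = hellinger (suc (length τ)) (conditional ν suppν τ) (conditional μ suppμ τ) in
                       h * h ≈ # 2 * x τ
    hellinger-square τ = trans (sqrt-square (≤-respʳ-≈ (sym eq) (#-nonNeg 2 ⟨*⟩ x-nonNeg τ))) eq
      where
      φ : Maybe String → ℝ
      φ c = geometricMean (mass? (mass ν) c ÷ mass ν τ) (mass? (mass μ) c ÷ mass μ τ)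
      eq : 2# * (1# - ∑-strings (suc (length τ)) (λ σ → φ (σ ⊓ τ))) ≈ # 2 * x τ
      -- `2#` unfolds to 1 + (1 + 0), `# 2` to 1 + 1. Off [τ] the factor q of the geometric mean is
      -- 0, so φ vanishes there.
      eq = *-cong (+-congˡ (+-identityʳ 1#)) (+-congˡ (-‿cong (∑-strings-meet τ φ
             (trans (*-congʳ (zeroˡ _)) (zeroˡ _)))))

    x≤H² : ∀ ω n → x (ω ↾ n) ≤ H n ν μ suppν suppμ ω * H n ν μ suppν suppμ ω
    x≤H² ω n = ≤-slack (x-nonNeg (ω ↾ n)) (begin
      x (ω ↾ n) + x (ω ↾ n)  ≈⟨ solve 1 (λ x → x :+ x := :# 2 :* x) refl (x (ω ↾ n)) ⟩
      # 2 * x (ω ↾ n)        ≈⟨ hellinger-square (ω ↾ n) ⟨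
      h (length (ω ↾ n)) * h (length (ω ↾ n))  ≡⟨ ≡.cong (λ k → h k * h k) (length-applyUpTo ω n) ⟩
      h n * h n              ∎)
      where
      open ≈-Reasoning setoid
      h : ℕ → ℝ
      h k = hellinger (suc k) (conditional ν suppν (ω ↾ n)) (conditional μ suppμ (ω ↾ n))

    -- The amount spent at the proper prefixes of σ. Leaving out `x σ` gives both children of a node
    -- the same value, on which `tree-bound` relies.
    T : String → ℝ
    T σ = ∑[ length σ ] (λ i → x (take i σ))

    T-∷ʳ : ∀ σ b → T (σ ∷ʳ b) ≈ T σ + x σ
    T-∷ʳ σ b = trans (reflexive (≡.cong (λ k → ∑[ k ] (λ i → x (take i (σ ∷ʳ b)))) (length-∷ʳ σ b)))
      (+-cong (∑-cong (length σ) λ i i<n → reflexive (≡.cong x (take-++-≤ i σ _ (ℕ.<⇒≤ i<n))))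
              (reflexive (≡.cong x (take-++ σ _))))

    T-++ : ∀ σ ρ → T σ ≤ T (σ ++ ρ)
    T-++ σ []      = ≤-reflexive (reflexive (≡.cong T (≡.sym (++-identityʳ σ))))
    T-++ σ (b ∷ ρ) = ≤-trans (≤-slack (x-nonNeg σ) (sym (T-∷ʳ σ b)))
      (≡.subst (λ τ → T (σ ∷ʳ b) ≤ T τ) (∷ʳ-++ σ b ρ) (T-++ (σ ∷ʳ b) ρ))

    T-take : ∀ k σ → T (take k σ) ≤ T σ
    T-take k σ = ≡.subst (λ τ → T (take k σ) ≤ T τ) (take++drop≡id k σ) (T-++ (take k σ) (drop k σ))

    T-↾ : ∀ ω n → T (ω ↾ n) ≈ ∑[ n ] (λ i → x (ω ↾ i))
    T-↾ ω n = trans (reflexive (≡.cong (λ k → ∑[ k ] (λ i → x (take i (ω ↾ n)))) (length-applyUpTo ω n)))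
      (∑-cong n λ i i<n → reflexive (≡.cong x (take-↾ ω (ℕ.<⇒≤ i<n))))

    -- An upper bound for ∑ (√ν − t√μ)² over the leaves below σ, if no path
    -- spends more than s of x from σ on.
    defect : ℝ → String → ℝ → ℝ
    defect t σ s = mass ν σ + t * t * mass μ σ - # 2 * (t * r σ * (1# - s))

    scaled-square : ∀ k t σ → # k * t * r σ * (# k * t * r σ) ≈ mass ν σ * (# k * # k * (t * t) * mass μ σ)
    scaled-square k t σ = trans
      (solve 3 (λ k t r → k :* t :* r :* (k :* t :* r) := k :* k :* (t :* t) :* (r :* r)) refl (# k) t (r σ))
      (trans (*-congˡ (r-square σ))
        (solve 4 (λ k t a b → k :* k :* (t :* t) :* (a :* b) := a :* (k :* k :* (t :* t) :* b)) refl (# k) t (mass ν σ) (mass μ σ)))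

    -- For k = 1 this is (√ν - t√μ)² ≥ 0, which makes the defect non-negative. For k = 2 it is (√ν -
    -- 2t√μ)² ≥ 0, which gives `leaf-bound`, since 2b + 2(√a - √b)² - a = (√a - 2√b)².
    scaled-am-gm : ∀ k t σ → # 2 * (# k * t * r σ) ≤ mass ν σ + # k * # k * (t * t) * mass μ σ
    scaled-am-gm k t σ = am-gm (nonNeg ν σ) (#-nonNeg k ⟨*⟩ #-nonNeg k ⟨*⟩ square-nonNeg t ⟨*⟩ nonNeg μ σ)
      (scaled-square k t σ)

    defect-nonNeg : ∀ {t} → 0# ≤ t → ∀ σ {s} → 0# ≤ s → 0# ≤ defect t σ s
    defect-nonNeg {t} 0≤t σ {s} 0≤s = ≤-respʳ-≈
      (solve 5 (λ a b t r s → a :+ :# 1 :* :# 1 :* (t :* t) :* b :- :# 2 :* (:# 1 :* t :* r) :+ :# 2 :* (t :* r :* s)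
          := a :+ t :* t :* b :- :# 2 :* (t :* r :* (:# 1 :- s))) refl (mass ν σ) (mass μ σ) t (r σ) s)
      (≤⇒0≤ (scaled-am-gm 1 t σ) ⟨+⟩ #-nonNeg 2 ⟨*⟩ (0≤t ⟨*⟩ r-nonNeg σ ⟨*⟩ 0≤s))

    -- a ≤ 2b + 2(√a − √b)² for a = ν σ and b = t²μ σ.
    leaf-bound : ∀ {t} → 0# ≤ t → ∀ σ {s} → 0# ≤ s → mass ν σ ≤ # 2 * (t * t * mass μ σ) + # 2 * defect t σ s
    leaf-bound {t} 0≤t σ {s} 0≤s = ≤-slack
      (≤⇒0≤ (scaled-am-gm 2 t σ) ⟨+⟩ #-nonNeg 4 ⟨*⟩ (0≤t ⟨*⟩ r-nonNeg σ ⟨*⟩ 0≤s))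
      (solve 5 (λ a b t r s → a :+ (a :+ :# 2 :* :# 2 :* (t :* t) :* b :- :# 2 :* (:# 2 :* t :* r) :+ :# 4 :* (t :* r :* s))
          := :# 2 :* (t :* t :* b) :+ :# 2 :* (a :+ t :* t :* b :- :# 2 :* (t :* r :* (:# 1 :- s)))) refl
          (mass ν σ) (mass μ σ) t (r σ) s)

    -- Passing to the children multiplies the sum of r by 1 - x and lowers the budget to s - x. The
    -- inequality is (1 - x)(1 - (s - x)) = 1 - s + x(s - x) ≥ 1 - s.
    defect-step : ∀ {t} → 0# ≤ t → ∀ σ {s} → x σ ≤ s →
      defect t (σ ∷ʳ false) (s - x σ) + defect t (σ ∷ʳ true) (s - x σ) ≤ defect t σ s
    defect-step {t} 0≤t σ {s} x≤s = ≤-slack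
      (#-nonNeg 2 ⟨*⟩ (0≤t ⟨*⟩ r-nonNeg σ ⟨*⟩ (x-nonNeg σ ⟨*⟩ ≤⇒0≤ x≤s))) (begin
        defect t (σ ∷ʳ false) (s - x σ) + defect t (σ ∷ʳ true) (s - x σ) + # 2 * (t * r σ * (x σ * (s - x σ)))
          ≈⟨ solve 10 (λ a₀ a₁ b₀ b₁ r₀ r₁ t s x r →
               a₀ :+ t :* t :* b₀ :- :# 2 :* (t :* r₀ :* (:# 1 :- (s :- x)))
               :+ (a₁ :+ t :* t :* b₁ :- :# 2 :* (t :* r₁ :* (:# 1 :- (s :- x))))
               :+ :# 2 :* (t :* r :* (x :* (s :- x)))
               := (a₀ :+ a₁) :+ t :* t :* (b₀ :+ b₁) :- :# 2 :* (t :* (r₀ :+ r₁) :* (:# 1 :- (s :- x)))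
               :+ :# 2 :* (t :* r :* (x :* (s :- x)))) refl
               _ _ _ _ _ _ t s (x σ) (r σ) ⟩
        (mass ν (σ ∷ʳ false) + mass ν (σ ∷ʳ true)) + t * t * (mass μ (σ ∷ʳ false) + mass μ (σ ∷ʳ true))
          - # 2 * (t * (r (σ ∷ʳ false) + r (σ ∷ʳ true)) * (1# - (s - x σ))) + # 2 * (t * r σ * (x σ * (s - x σ)))
          ≈⟨ +-congʳ (+-cong (+-cong (sym (additive ν σ)) (*-congˡ (sym (additive μ σ))))
               (-‿cong (*-congˡ (*-congʳ (*-congˡ (r-step σ)))))) ⟩
        mass ν σ + t * t * mass μ σ
          - # 2 * (t * ((1# - x σ) * r σ) * (1# - (s - x σ))) + # 2 * (t * r σ * (x σ * (s - x σ)))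
          ≈⟨ solve 6 (λ a b t s x r →
               a :+ t :* t :* b :- :# 2 :* (t :* ((:# 1 :- x) :* r) :* (:# 1 :- (s :- x)))
               :+ :# 2 :* (t :* r :* (x :* (s :- x)))
               := a :+ t :* t :* b :- :# 2 :* (t :* r :* (:# 1 :- s))) refl
               (mass ν σ) (mass μ σ) t s (x σ) (r σ) ⟩
        defect t σ s ∎)
      where open ≈-Reasoning setoid

    defect-cong : ∀ t σ {s s′} → s ≈ s′ → defect t σ s ≈ defect t σ s′
    defect-cong t σ s≈s′ = +-congˡ (-‿cong (*-congˡ (*-congˡ (+-congˡ (-‿cong s≈s′)))))

    -- B - T σ is the budget left at σ. While it allows `x σ`, the defect passes to the children by
    -- `defect-step`. Once T σ + x σ exceeds B, both children exceed B, so F is empty below σ: the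
    -- left side is 0 and the right side is non-negative.
    tree-bound : ∀ (F : Pred String 0ℓ) {t B} → 0# ≤ t → ∀ m σ → T σ ≤ B →
      (∀ ρ → F (σ ++ ρ) → T (σ ++ ρ) ≤ B) →
      ∑ext m σ (restrict F (mass ν)) ≤ # 2 * (t * t * ∑ext m σ (restrict F (mass μ))) + # 2 * defect t σ (B - T σ)
    tree-bound F {t} {B} 0≤t zero σ Tσ≤B F⇒T≤B with em {F σ}
    ... | yes _ = leaf-bound 0≤t σ (≤⇒0≤ Tσ≤B)
    ... | no  _ = #-nonNeg 2 ⟨*⟩ (square-nonNeg t ⟨*⟩ ≤-refl) ⟨+⟩ #-nonNeg 2 ⟨*⟩ defect-nonNeg 0≤t σ (≤⇒0≤ Tσ≤B)
    tree-bound F {t} {B} 0≤t (suc m) σ Tσ≤B F⇒T≤B with em {T σ + x σ ≤ B}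
    ... | yes Tσ+x≤B = begin
      ∑ext m (σ ∷ʳ false) fν + ∑ext m (σ ∷ʳ true) fν
        ≤⟨ +-mono-≤ (branch false) (branch true) ⟩
      # 2 * (t * t * ∑ext m (σ ∷ʳ false) fμ) + # 2 * defect t (σ ∷ʳ false) (s - x σ)
        + (# 2 * (t * t * ∑ext m (σ ∷ʳ true) fμ) + # 2 * defect t (σ ∷ʳ true) (s - x σ))
        ≈⟨ solve 5 (λ t a b c d → :# 2 :* (t :* a) :+ :# 2 :* b :+ (:# 2 :* (t :* c) :+ :# 2 :* d)
             := :# 2 :* (t :* (a :+ c)) :+ :# 2 :* (b :+ d)) refl (t * t) _ _ _ _ ⟩
      # 2 * (t * t * ∑ext (suc m) σ fμ) + # 2 * (defect t (σ ∷ʳ false) (s - x σ) + defect t (σ ∷ʳ true) (s - x σ))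
        ≤⟨ +-mono-≤ ≤-refl (*-monoˡ-≤ (# 2) (#-nonNeg 2) (defect-step 0≤t σ x≤s)) ⟩
      # 2 * (t * t * ∑ext (suc m) σ fμ) + # 2 * defect t σ s ∎
      where
      open ≤-Reasoning poset
      fν fμ : String → ℝ
      fν = restrict F (mass ν)
      fμ = restrict F (mass μ)
      s : ℝ
      s = B - T σ
      x≤s : x σ ≤ s
      x≤s = ≤-slack (≤⇒0≤ Tσ+x≤B) (solve 3 (λ x b t → x :+ (b :- (t :+ x)) := b :- t) refl (x σ) B (T σ))
      branch : ∀ b → ∑ext m (σ ∷ʳ b) fν ≤ # 2 * (t * t * ∑ext m (σ ∷ʳ b) fμ) + # 2 * defect t (σ ∷ʳ b) (s - x σ)
      branch b = ≤-trans
        (tree-bound F 0≤t m (σ ∷ʳ b) (≤-respˡ-≈ (sym (T-∷ʳ σ b)) Tσ+x≤B)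
          λ ρ → ≡.subst (λ τ → F τ → T τ ≤ B) (≡.sym (∷ʳ-++ σ b ρ)) (F⇒T≤B (b ∷ ρ)))
        (≤-reflexive (+-congˡ (*-congˡ (defect-cong t (σ ∷ʳ b) (trans (+-congˡ (-‿cong (T-∷ʳ σ b)))
          (solve 3 (λ b t x → b :- (t :+ x) := b :- t :- x) refl B (T σ) (x σ)))))))
    ... | no Tσ+x≰B = ≤-respˡ-≈ (sym (trans (+-cong (vanish false) (vanish true)) (+-identityˡ 0#)))
      (#-nonNeg 2 ⟨*⟩ (square-nonNeg t ⟨*⟩ ∑ext-nonNeg (suc m) σ (restrict-nonNeg F (nonNeg μ)))
        ⟨+⟩ #-nonNeg 2 ⟨*⟩ defect-nonNeg 0≤t σ (≤⇒0≤ Tσ≤B))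
      where
      vanish : ∀ b → ∑ext m (σ ∷ʳ b) (restrict F (mass ν)) ≈ 0#
      vanish b = trans (∑ext-cong m (σ ∷ʳ b) λ ρ _ → reflexive (restrict-∉ (mass ν) λ f →
        Tσ+x≰B (≤-respˡ-≈ (T-∷ʳ σ b) (≤-trans (T-++ (σ ∷ʳ b) ρ)
          (≡.subst (λ τ → F τ → T τ ≤ B) (≡.sym (∷ʳ-++ σ b ρ)) (F⇒T≤B (b ∷ ρ)) f))))) (∑ext-0 m _)

    -- This is √(ν σ / μ σ), the t for which t²μ agrees with ν at σ; the defect there is then
    -- proportional to the budget s.
    ratio : String → ℝ
    ratio σ = r σ ÷ mass μ σ

    ratio-nonNeg : ∀ σ → 0# ≤ ratio σ
    ratio-nonNeg σ = r-nonNeg σ ⟨*⟩ ⁻¹-nonNeg (suppμ σ)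

    ratio²-μ : ∀ σ → ratio σ * ratio σ * mass μ σ ≈ ratio σ * r σ
    ratio²-μ σ = trans (solve 2 (λ t m → t :* t :* m := t :* (m :* t)) refl (ratio σ) (mass μ σ))
      (*-congˡ (*-÷-cancel (0<⇒≉0 (suppμ σ))))

    ratio-r : ∀ σ → ratio σ * r σ ≈ mass ν σ
    ratio-r σ = begin
      r σ * mass μ σ ⁻¹ * r σ   ≈⟨ solve 2 (λ a b → a :* b :* a := a :* a :* b) refl (r σ) (mass μ σ ⁻¹) ⟩
      r σ * r σ * mass μ σ ⁻¹   ≈⟨ *-congʳ (r-square σ) ⟩
      mass ν σ * mass μ σ * mass μ σ ⁻¹  ≈⟨ *-assoc _ _ _ ⟩
      mass ν σ * (mass μ σ * mass μ σ ⁻¹) ≈⟨ *-congˡ (⁻¹-inverseʳ (0<⇒≉0 (suppμ σ))) ⟩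
      mass ν σ * 1#             ≈⟨ *-identityʳ _ ⟩
      mass ν σ                  ∎
      where open ≈-Reasoning setoid

    defect-ratio : ∀ σ s → defect (ratio σ) σ s ≈ # 2 * (s * mass ν σ)
    defect-ratio σ s = trans
      (+-cong (+-congˡ (trans (ratio²-μ σ) (ratio-r σ))) (-‿cong (*-congˡ (*-congʳ (ratio-r σ)))))
      (solve 2 (λ a s → a :+ a :- :# 2 :* (a :* (:# 1 :- s)) := :# 2 :* (s :* a)) refl (mass ν σ) s)

    cylinder-bound : ∀ (F : Pred String 0ℓ) {δ} → 0# ≤ δ → ∀ m σ →
      (∀ ρ → F (σ ++ ρ) → T (σ ++ ρ) ≤ T σ + δ) →
      ∑ext m σ (restrict F (mass ν)) ≤ # 2 * (ratio σ * ratio σ * ∑ext m σ (restrict F (mass μ))) + # 4 * δ * mass ν σ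
    cylinder-bound F {δ} 0≤δ m σ F⇒T≤ = ≤-trans
      (tree-bound F (ratio-nonNeg σ) m σ (≤-slack 0≤δ refl) F⇒T≤)
      (≤-reflexive (+-congˡ (trans (*-congˡ (trans
          (defect-cong (ratio σ) σ (solve 2 (λ t d → t :+ d :- t := d) refl (T σ) δ)) (defect-ratio σ δ)))
        (solve 2 (λ d a → :# 2 :* (:# 2 :* (d :* a)) := :# 4 :* d :* a) refl δ (mass ν σ)))))

    bounded-on-level : ∀ N (f : String → ℝ) → (∀ σ → 0# ≤ f σ) →
                       ∃[ K ] 0# < K × (∀ σ → length σ ≡ N → f σ ≤ K)
    bounded-on-level zero f 0≤f = 1# + f [] , <-≤-trans 0<1 (≤-slack (0≤f []) refl) ,
      λ where [] ≡.refl → ≤-slack 0≤1 (+-comm _ _)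
    bounded-on-level (suc N) f 0≤f
      with bounded-on-level N (f ∘ (false ∷_)) (0≤f ∘ (false ∷_)) | bounded-on-level N (f ∘ (true ∷_)) (0≤f ∘ (true ∷_))
    ... | K₀ , 0<K₀ , b₀ | K₁ , 0<K₁ , b₁ = K₀ + K₁ , <-≤-trans 0<K₀ (≤-slack (<⇒≤ 0<K₁) refl) , λ where
      (false ∷ σ) eq → ≤-trans (b₀ σ (ℕ.suc-injective eq)) (≤-slack (<⇒≤ 0<K₁) refl)
      (true ∷ σ)  eq → ≤-trans (b₁ σ (ℕ.suc-injective eq)) (≤-slack (<⇒≤ 0<K₀) (+-comm _ _))

    abstract
      -- K bounds the squared ratios over the finitely many strings of level N. It is fixed before F
      -- and m, so F may come from a cover chosen small relative to K.
      level-bound : ∀ N {δ} → 0# ≤ δ → ∃[ K ] 0# < K × (∀ F → (∀ σ → F σ → T σ ≤ T (take N σ) + δ) →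
        ∀ m → level ν (N ℕ.+ m) F ≤ # 2 * K * level μ (N ℕ.+ m) F + # 4 * δ)
      level-bound N {δ} 0≤δ with bounded-on-level N (λ σ → ratio σ * ratio σ) (λ σ → square-nonNeg _)
      ... | K , 0<K , ratio²≤K = K , 0<K , λ F F⇒T≤ m → begin
        level ν (N ℕ.+ m) F
          ≈⟨ ∑ext-split N m [] _ ⟩
        ∑ext N [] (λ σ → ∑ext m σ (restrict F (mass ν)))
          ≤⟨ ∑ext-mono N [] (λ σ |σ|≡N → begin
               ∑ext m σ (restrict F (mass ν))
                 ≤⟨ cylinder-bound F 0≤δ m σ (λ ρ f → ≡.subst (λ τ → T (σ ++ ρ) ≤ T τ + δ)
                      (≡.trans (≡.cong (λ k → take k (σ ++ ρ)) (≡.sym |σ|≡N)) (take-++ σ ρ)) (F⇒T≤ (σ ++ ρ) f)) ⟩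
               # 2 * (ratio σ * ratio σ * ∑ext m σ (restrict F (mass μ))) + # 4 * δ * mass ν σ
                 ≤⟨ +-mono-≤ (*-monoˡ-≤ (# 2) (#-nonNeg 2)
                      (≤-slack (≤⇒0≤ (ratio²≤K σ |σ|≡N) ⟨*⟩ ∑ext-nonNeg m σ (restrict-nonNeg F (nonNeg μ)))
                        (solve 3 (λ a b c → a :* c :+ (b :- a) :* c := b :* c) refl _ K _))) ≤-refl ⟩
               # 2 * (K * ∑ext m σ (restrict F (mass μ))) + # 4 * δ * mass ν σ
                 ≈⟨ +-congʳ (sym (*-assoc _ _ _)) ⟩
               # 2 * K * ∑ext m σ (restrict F (mass μ)) + # 4 * δ * mass ν σ ∎) ⟩
        ∑ext N [] (λ σ → # 2 * K * ∑ext m σ (restrict F (mass μ)) + # 4 * δ * mass ν σ)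
          ≈⟨ trans (∑ext-+ N [] _ _) (+-cong (∑ext-* N [] _ _) (∑ext-* N [] _ _)) ⟩
        # 2 * K * ∑ext N [] (λ σ → ∑ext m σ (restrict F (mass μ))) + # 4 * δ * ∑ext N [] (mass ν)
          ≈⟨ +-cong (*-congˡ (sym (∑ext-split N m [] _)))
               (trans (*-congˡ (trans (∑ext-additive N [] (additive ν)) (mass-[] ν))) (*-identityʳ _)) ⟩
        # 2 * K * level μ (N ℕ.+ m) F + # 4 * δ ∎
        where open ≤-Reasoning poset

-- König's lemma for binary trees.

module König (em : ExcludedMiddle 0ℓ) (Q : Pred String 0ℓ) (prefix-closed : ∀ σ ρ → Q (σ ++ ρ) → Q σ) where

  Infinite : Pred String 0ℓ
  Infinite σ = ∀ m → ∃[ ρ ] length ρ ≡ m × Q (σ ++ ρ)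

  infinite-child : ∀ σ → Infinite σ → ∃[ b ] Infinite (σ ∷ʳ b)
  infinite-child σ inf with em {Infinite (σ ∷ʳ false)}
  ... | yes inf₀ = false , inf₀
  -- If the true child has no extension of length m in Q and the false child none of length m₀, an
  -- extension of σ of length 1 + m + m₀ is impossible: truncating it contradicts one of the two.
  ... | no ¬inf₀ = true , λ m → decidable-stable em λ ¬∃₁ → ¬inf₀ λ m₀ → branch m m₀ ¬∃₁ (inf (suc (m ℕ.+ m₀)))
    where
    shorten : ∀ b k l ρ → length ρ ≡ k ℕ.+ l → Q (σ ++ b ∷ ρ) → ∃[ ρ′ ] length ρ′ ≡ k × Q ((σ ∷ʳ b) ++ ρ′)
    shorten b k l ρ eq q = take k ρ ,
      ≡.trans (length-take k ρ) (ℕ.m≤n⇒m⊓n≡m (≡.subst (k ℕ.≤_) (≡.sym eq) (ℕ.m≤m+n k l))) ,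
      prefix-closed _ (drop k ρ) (≡.subst Q
        (≡.trans (≡.sym (∷ʳ-++ σ b ρ)) (≡.trans (≡.cong ((σ ∷ʳ b) ++_) (≡.sym (take++drop≡id k ρ)))
          (≡.sym (++-assoc (σ ∷ʳ b) (take k ρ) (drop k ρ))))) q)
    branch : ∀ m m₀ → ¬ (∃[ ρ ] length ρ ≡ m × Q ((σ ∷ʳ true) ++ ρ)) →
             ∃[ ρ ] length ρ ≡ suc (m ℕ.+ m₀) × Q (σ ++ ρ) →
             ∃[ ρ ] length ρ ≡ m₀ × Q ((σ ∷ʳ false) ++ ρ)
    branch m m₀ ¬∃₁ (false ∷ ρ , eq , q) =
      shorten false m₀ m ρ (≡.trans (ℕ.suc-injective eq) (ℕ.+-comm m m₀)) q
    branch m m₀ ¬∃₁ (true ∷ ρ , eq , q) =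
      contradiction (shorten true m m₀ ρ (ℕ.suc-injective eq) q) ¬∃₁

  module _ (infinite : Infinite []) where
    node : ℕ → ∃[ σ ] Infinite σ
    node zero    = [] , infinite
    node (suc n) with node n
    ... | σ , inf with infinite-child σ inf
    ...   | b , inf′ = σ ∷ʳ b , inf′

    path : Cantor
    path n = let σ , inf = node n in proj₁ (infinite-child σ inf)

    path-↾ : ∀ n → path ↾ n ≡ proj₁ (node n)
    path-↾ zero    = ≡.refl
    path-↾ (suc n) = ≡.trans (≡.sym (applyUpTo-∷ʳ path n)) (≡.cong (_∷ʳ path n) (path-↾ n))

    path-∈ : ∀ n → Q (path ↾ n)
    path-∈ n with proj₂ (node n) 0
    ... | [] , _ , q = ≡.subst Q (≡.trans (++-identityʳ _) (≡.sym (path-↾ n))) q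

-- Smallness of the overspending sets; transfer of null sets.

module AbsoluteContinuity (em : ExcludedMiddle 0ℓ) (R : CompleteOrderedField) where
  open CompleteOrderedField R hiding (zero)
  open OverReals R
  open IntegerRingSolver R
  open OrderedFieldProperties em R
  open LevelSums em R
  open Affinity em R

  geometric : ℝ → ℕ → ℝ
  geometric ε zero    = ε
  geometric ε (suc n) = geometric ε n * (# 2) ⁻¹

  geometric-pos : ∀ {ε} → 0# < ε → ∀ n → 0# < geometric ε n
  geometric-pos 0<ε zero    = 0<ε
  geometric-pos 0<ε (suc n) = ÷-pos 1 (geometric-pos 0<ε n)

  ∑-geometric : ∀ ε n → ∑[ n ] (geometric ε ∘ suc) + geometric ε n ≈ ε
  ∑-geometric ε zero    = +-identityˡ ε
  ∑-geometric ε (suc n) = begin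
    ∑[ n ] (geometric ε ∘ suc) + half + half    ≈⟨ solve 2 (λ s h → s :+ h :+ h := s :+ :# 2 :* h) refl _ half ⟩
    ∑[ n ] (geometric ε ∘ suc) + # 2 * half     ≈⟨ +-congˡ (*-÷-cancel (0<⇒≉0 (#-pos 1))) ⟩
    ∑[ n ] (geometric ε ∘ suc) + geometric ε n  ≈⟨ ∑-geometric ε n ⟩
    ε                                           ∎
    where
    open ≈-Reasoning setoid
    half = geometric ε (suc n)

  ∑-geometric-≤ : ∀ {ε} → 0# < ε → ∀ n → ∑[ n ] (geometric ε ∘ suc) ≤ ε
  ∑-geometric-≤ {ε} 0<ε n = ≤-slack (<⇒≤ (geometric-pos 0<ε n)) (∑-geometric ε n)

  -- Adds the slacks of l + t ≤ b and b ≤ t + g to obtain l ≤ g.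
  telescope : ∀ l t b g → l + (b - (l + t) + (t + g - b)) ≈ g
  telescope = solve 4 (λ l t b g → l :+ (b :- (l :+ t) :+ (t :+ g :- b)) := g) refl

  ≤-∑ℕ : ∀ (f : ℕ → ℕ) M → ∃[ s ] ∀ j → j ℕ.< M → f j ℕ.≤ s
  ≤-∑ℕ f zero    = 0 , λ _ ()
  ≤-∑ℕ f (suc M) with ≤-∑ℕ f M
  ... | s , f≤s = f M ℕ.+ s , λ j j<1+M → bound j (ℕ.m≤n⇒m<n∨m≡n (ℕ.s≤s⁻¹ j<1+M))
    where
    bound : ∀ j → j ℕ.< M ⊎ j ≡ M → f j ℕ.≤ f M ℕ.+ s
    bound j (inj₁ j<M)    = ℕ.≤-trans (f≤s j j<M) (ℕ.m≤n+m s (f M))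
    bound j (inj₂ ≡.refl) = ℕ.m≤m+n (f M) s

  level-⊎ : ∀ ν m P Q S → (∀ σ → P σ → Q σ ⊎ S σ) → level ν m P ≤ level ν m Q + level ν m S
  level-⊎ ν m P Q S P⇒ = ≤-respʳ-≈ (∑ext-+ m [] _ _)
    (∑ext-mono m [] λ ρ _ → restrict-⊎ P Q S (nonNeg ν) ρ (P⇒ ρ))

  level-difference : ∀ ν m {P} → ExtensionClosed P → ∀ k →
    level ν m (λ σ → P σ × ¬ P (take k σ)) + level ν m (P ∘ take k) ≤ level ν m P
  level-difference ν m {P} ext k = ≤-respˡ-≈ (∑ext-+ m [] _ _) (∑ext-mono m [] λ ρ _ → leaf ρ)
    where
    leaf : ∀ σ → restrict (λ σ → P σ × ¬ P (take k σ)) (mass ν) σ + restrict (P ∘ take k) (mass ν) σ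
                 ≤ restrict P (mass ν) σ
    leaf σ with em {P (take k σ)}
    ... | yes p = ≤-reflexive (trans (+-congʳ (reflexive (restrict-∉ (mass ν) λ (_ , ¬p) → ¬p p)))
                    (trans (+-identityˡ _) (reflexive (≡.sym (restrict-∈ (mass ν)
                      (≡.subst P (take++drop≡id k σ) (ext (take k σ) (drop k σ) p)))))))
    ... | no _  = ≤-respˡ-≈ (sym (+-identityʳ _)) (restrict-mono _ P (nonNeg ν) σ proj₁)

  module _ (ν μ : Measure) (suppν : FullSupport ν) (suppμ : FullSupport μ) where

    private
      xs : Cantor → ℕ → ℝ
      xs ω i = x ν μ suppν suppμ (ω ↾ i)

      Ts : String → ℝ
      Ts = T ν μ suppν suppμ

    module _ {δ : ℝ} (0<δ : 0# < δ) where

      Bad : ℕ → Pred String 0ℓ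
      Bad N σ = Ts (take N σ) + δ < Ts σ

      ¬Bad⇒≤ : ∀ N σ → ¬ Bad N σ → Ts σ ≤ Ts (take N σ) + δ
      ¬Bad⇒≤ N σ ¬bad = decidable-stable em (¬bad ∘ ≰⇒>)

      -- If σ is shorter than N, `take N σ` is σ itself and nothing has been spent since. Hence
      -- extending a bad string leaves its prefix of length N unchanged.
      Bad⇒≤ : ∀ N σ → Bad N σ → N ℕ.≤ length σ
      Bad⇒≤ N σ bad = ℕ.≮⇒≥ λ |σ|<N → <⇒≱ bad (≤-slack (<⇒≤ 0<δ)
        (+-congʳ (reflexive (≡.cong Ts (≡.sym (take-all N σ (ℕ.<⇒≤ |σ|<N)))))))

      Bad-extensionClosed : ∀ N → ExtensionClosed (Bad N)
      Bad-extensionClosed N σ ρ bad = <-≤-trans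
        (≡.subst (λ τ → Ts τ + δ < Ts σ) (≡.sym (take-++-≤ N σ ρ (Bad⇒≤ N σ bad))) bad)
        (T-++ ν μ suppν suppμ σ ρ)

      Bad-antitone : ∀ {j N} σ → j ℕ.≤ N → Bad N σ → Bad j σ
      Bad-antitone {j} {N} σ j≤N bad = ≰⇒> λ Tσ≤ → <⇒≱ bad (≤-trans Tσ≤ (+-mono-≤
        (≡.subst (λ τ → Ts τ ≤ Ts (take N σ)) (take-take-≤ σ j≤N) (T-take ν μ suppν suppμ j (take N σ)))
        ≤-refl))

      summable⇒¬Bad : ∀ ω → Summable (xs ω) → ∃[ N ] ∀ m → ¬ Bad N (ω ↾ m)
      summable⇒¬Bad ω (b , ∑≤b)
        with bounded⇒almost-maximal (λ n → ∑[ n ] (xs ω)) b ∑≤b 0<δ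
      ... | N , max = N , λ m bad → <⇒≱ bad (≤-respˡ-≈ (sym (T-↾ ν μ suppν suppμ ω m)) (≤-trans (max m)
        (≤-reflexive (+-congʳ (trans (sym (T-↾ ν μ suppν suppμ ω N)) (reflexive (≡.cong Ts
          (≡.sym (take-↾ ω (≡.subst (N ℕ.≤_) (length-applyUpTo ω m) (Bad⇒≤ N _ bad)))))))))))

      module _ {ε : ℝ} (0<ε : 0# < ε) (E : ℕ → Maybe String)
               (covers : Covers E (∁ (Summable ∘ xs)))
               (∑E≤ε : ∀ n → ∑[ n ] (mass? (mass ν) ∘ E) ≤ ε) where

        private
          -- Chooses a length at which all but ε/2^(j+1) of the ν-measure of the open set `Bad j` is
          -- already visible.
          almost : ∀ j → ∃[ n ] ∀ m → level ν m (Bad j) ≤ level ν n (Bad j) + geometric ε (suc j)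
          almost j = bounded⇒almost-maximal (λ m → level ν m (Bad j)) 1# (λ m → level-≤-1 ν m (Bad j))
                       (geometric-pos 0<ε (suc j))

          depth : ℕ → ℕ
          depth j = proj₁ (almost j)

          -- What is lost when `Bad j` is replaced by its clopen part decided at length `depth j`.
          Late : ℕ → Pred String 0ℓ
          Late j σ = Bad j σ × ¬ Bad j (take (depth j) σ)

          level-Late : ∀ j m → depth j ℕ.≤ m → level ν m (Late j) ≤ geometric ε (suc j)
          level-Late j m d≤m = ≤-slack
            (≤⇒0≤ (level-difference ν m (Bad-extensionClosed j) (depth j)) ⟨+⟩ ≤⇒0≤ (proj₂ (almost j) m))
            (trans (+-congˡ (+-congˡ (+-congʳ (+-congʳ (sym early)))))
              (telescope (level ν m (Late j)) (level ν m (Bad j ∘ take (depth j)))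
                (level ν m (Bad j)) (geometric ε (suc j))))
            where
            early : level ν m (Bad j ∘ take (depth j)) ≈ level ν (depth j) (Bad j)
            early = ≡.subst (λ k → level ν k (Bad j ∘ take (depth j)) ≈ level ν (depth j) (Bad j))
              (ℕ.m+[n∸m]≡n d≤m) (level-take ν (depth j) (m ℕ.∸ depth j) (Bad j))

          -- `Bad j` is closed under extensions, whereas König's lemma needs a set closed under
          -- prefixes. So badness is asked of the prefix of length `depth j`, and the guards
          -- postpone this until σ is long enough to decide it.
          Survives : Pred String 0ℓ
          Survives σ = ¬ Covered E σ × (∀ j → j ℕ.< length σ → depth j ℕ.≤ length σ → Bad j (take (depth j) σ))

          survives-prefix : ∀ σ ρ → Survives (σ ++ ρ) → Survives σ
          survives-prefix σ ρ (¬cov , bad) = ¬cov ∘ Covered-extensionClosed E σ ρ , λ j j<|σ| d≤|σ| →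
            ≡.subst (Bad j) (take-++-≤ (depth j) σ ρ d≤|σ|)
              (bad j (ℕ.<-≤-trans j<|σ| |σ|≤) (ℕ.≤-trans d≤|σ| |σ|≤))
            where
            |σ|≤ : length σ ℕ.≤ length (σ ++ ρ)
            |σ|≤ = ≡.subst (length σ ℕ.≤_) (≡.sym (length-++ σ)) (ℕ.m≤m+n _ _)

          open König em Survives survives-prefix

          -- Otherwise Bad M would, at a deep level, be covered by E, of measure at
          -- most ε, and the sets Late j with j < M, of total measure at most ε.
          ∃-survivor : ∀ M n → ¬ level ν n (Bad M) ≤ ε + ε → ∃[ ρ ] length ρ ≡ M × Survives ρ
          ∃-survivor M n large = let σ , _ , witness = decidable-stable em (large ∘ small) in
            take M σ , truncate σ witness
            where
            s m : ℕ
            s = proj₁ (≤-∑ℕ depth M)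
            -- Beyond every `depth j` with j < M, so that `level-Late` applies, and of the form n +
            -- k for `level-≤-+`.
            m = n ℕ.+ (M ℕ.+ s)

            depth≤m : ∀ {j} → j ℕ.< M → depth j ℕ.≤ m
            depth≤m j<M = ℕ.≤-trans (proj₂ (≤-∑ℕ depth M) _ j<M)
              (ℕ.≤-trans (ℕ.m≤n+m s M) (ℕ.m≤n+m (M ℕ.+ s) n))

            Escapes : Pred String 0ℓ
            Escapes σ = Bad M σ × ¬ Covered E σ × (∀ j → j ℕ.< M → ¬ Late j σ)

            truncate : ∀ σ → Escapes σ → length (take M σ) ≡ M × Survives (take M σ)
            truncate σ (bad , ¬cov , ¬late) = |take| ,
              (λ cov → ¬cov (≡.subst (Covered E) (take++drop≡id M σ)
                (Covered-extensionClosed E (take M σ) (drop M σ) cov))) ,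
              λ j j<|take| d≤|take| →
                let j<M = ≡.subst (j ℕ.<_) |take| j<|take|
                    d≤M = ≡.subst (depth j ℕ.≤_) |take| d≤|take|
                -- A string in `Bad M` is in `Bad j`; not being late, it is bad already at length
                -- `depth j`.
                in ≡.subst (Bad j) (≡.sym (take-take-≤ σ d≤M)) (decidable-stable em λ ¬early →
                     ¬late j j<M (Bad-antitone σ (ℕ.<⇒≤ j<M) bad , ¬early))
              where
              |take| : length (take M σ) ≡ M
              |take| = ≡.trans (length-take M σ) (ℕ.m≤n⇒m⊓n≡m (Bad⇒≤ M σ bad))

            cov late : String → ℝ
            cov σ = restrict (Covered E) (mass ν) σ
            late σ = ∑[ M ] (λ j → restrict (Late j) (mass ν) σ)

            0≤cov : ∀ σ → 0# ≤ cov σ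
            0≤cov = restrict-nonNeg (Covered E) (nonNeg ν)

            0≤late : ∀ σ j → 0# ≤ restrict (Late j) (mass ν) σ
            0≤late σ j = restrict-nonNeg (Late j) (nonNeg ν) σ

            leaf : ¬ (∃[ σ ] length σ ≡ m × Escapes σ) → ∀ σ → length σ ≡ m →
                   restrict (Bad M) (mass ν) σ ≤ cov σ + late σ
            leaf ¬esc σ |σ|≡m = restrict-≤-intro (Bad M) (mass ν) σ
              (0≤cov σ ⟨+⟩ ∑-nonNeg M (0≤late σ)) λ bad → decidable-stable em λ ¬≤ →
              ¬esc (σ , |σ|≡m , bad ,
                (λ c → ¬≤ (≤-slack (∑-nonNeg M (0≤late σ))
                  (+-congʳ (reflexive (≡.sym (restrict-∈ {Covered E} (mass ν) c)))))) ,
                (λ j j<M l → ¬≤ (≤-trans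
                  (≤-trans (≤-reflexive (reflexive (≡.sym (restrict-∈ {Late j} (mass ν) l))))
                    (∑-term M {λ j → restrict (Late j) (mass ν) σ} (0≤late σ) j<M))
                  (≤-slack (0≤cov σ) (+-comm _ _)))))

            small : ¬ (∃[ σ ] length σ ≡ m × Escapes σ) → level ν n (Bad M) ≤ ε + ε
            small ¬esc = begin
              level ν n (Bad M)                      ≤⟨ level-≤-+ ν (Bad-extensionClosed M) n (M ℕ.+ s) ⟩
              level ν m (Bad M)                      ≤⟨ ∑ext-mono m [] (leaf ¬esc) ⟩
              ∑ext m [] (λ σ → cov σ + late σ)          ≈⟨ ∑ext-+ m [] cov late ⟩
              level ν m (Covered E) + ∑ext m [] late  ≈⟨ +-congˡ (∑ext-∑ m [] M (λ j → restrict (Late j) (mass ν))) ⟩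
              level ν m (Covered E) + ∑[ M ] (λ j → level ν m (Late j))
                ≤⟨ +-mono-≤ (≤-trans (level-Covered-≤ ν E m) (∑E≤ε m))
                     (≤-trans (∑-mono M λ j j<M → level-Late j m (depth≤m j<M)) (∑-geometric-≤ 0<ε M)) ⟩
              ε + ε                                  ∎
              where open ≤-Reasoning poset

          no-survivor : ¬ (∀ M → ∃[ ρ ] length ρ ≡ M × Survives ρ)
          no-survivor infinite = contradiction summable λ sum →
              let N , ¬bad = summable⇒¬Bad ω sum in ¬bad (depth N) (bad-ω N)
            where
            ω : Cantor
            ω = path infinite
            bad-ω : ∀ N → Bad N (ω ↾ depth N)
            bad-ω N = ≡.subst (Bad N) (take-↾ ω (ℕ.m≤n+m (depth N) (suc N)))
              (proj₂ (path-∈ infinite k) N (≡.subst (N ℕ.<_) |ω↾k| (ℕ.m≤m+n (suc N) (depth N)))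
                 (≡.subst (depth N ℕ.≤_) |ω↾k| (ℕ.m≤n+m (depth N) (suc N))))
              where
              -- Long enough to activate both guards of `Survives` at j = N.
              k = suc N ℕ.+ depth N
              |ω↾k| : k ≡ length (ω ↾ k)
              |ω↾k| = ≡.sym (length-applyUpTo ω k)
            summable : Summable (xs ω)
            summable = decidable-stable em λ ¬sum →
              let k , cov = Covered-covers covers ¬sum in proj₁ (path-∈ infinite k) cov

        abstract
          ∃-Bad-small : ∃[ N ] ∀ n → level ν n (Bad N) ≤ ε + ε
          ∃-Bad-small = decidable-stable em λ ¬small → no-survivor λ M →
            let n , large = decidable-stable em λ ¬large → ¬small (M , λ n →
                  decidable-stable em λ large → ¬large (n , large))
            in ∃-survivor M n large

    Bad∪Covered : ∀ {δ} → 0# < δ → ℕ → (ℕ → Maybe String) → Pred String 0ℓ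
    Bad∪Covered 0<δ N C σ = Bad 0<δ N σ ⊎ Covered C σ

    level-Bad∪Covered : ∀ {δ} (0<δ : 0# < δ) N → (∀ m → level ν m (Bad 0<δ N) ≤ δ + δ) →
      ∀ {K} → 0# < K →
      (∀ F → (∀ σ → F σ → Ts σ ≤ Ts (take N σ) + δ) → ∀ m →
        level ν (N ℕ.+ m) F ≤ # 2 * K * level μ (N ℕ.+ m) F + # 4 * δ) →
      ∀ C → (∀ n → ∑[ n ] (mass? (mass μ) ∘ C) ≤ δ * K ⁻¹) →
      ∀ m → level ν (N ℕ.+ m) (Bad∪Covered 0<δ N C) ≤ # 8 * δ
    level-Bad∪Covered {δ} 0<δ N Bad≤ {K} 0<K transfer C ∑C≤ m = begin
      level ν n (Bad∪Covered 0<δ N C)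
        ≤⟨ level-⊎ ν n (Bad∪Covered 0<δ N C) (Bad 0<δ N) F split ⟩
      level ν n (Bad 0<δ N) + level ν n F
        ≤⟨ +-mono-≤ (Bad≤ n) (transfer F (λ σ f → ¬Bad⇒≤ 0<δ N σ (proj₂ f)) m) ⟩
      δ + δ + (# 2 * K * level μ n F + # 4 * δ)
        ≤⟨ +-mono-≤ ≤-refl (+-mono-≤ (*-monoˡ-≤ (# 2 * K) (#-nonNeg 2 ⟨*⟩ <⇒≤ 0<K) μF≤) ≤-refl) ⟩
      δ + δ + (# 2 * K * (δ * K ⁻¹) + # 4 * δ)
        ≈⟨ +-congˡ (+-congʳ (trans (*-assoc (# 2) K (δ * K ⁻¹)) (*-congˡ (*-÷-cancel (0<⇒≉0 0<K))))) ⟩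
      δ + δ + (# 2 * δ + # 4 * δ)
        ≈⟨ solve 1 (λ d → d :+ d :+ (:# 2 :* d :+ :# 4 :* d) := :# 8 :* d) refl δ ⟩
      # 8 * δ ∎
      where
      open ≤-Reasoning poset
      n : ℕ
      n = N ℕ.+ m
      F : Pred String 0ℓ
      -- `transfer` applies only to strings within the budget, so the bad ones are removed and
      -- counted separately.
      F σ = Covered C σ × ¬ Bad 0<δ N σ
      split : ∀ σ → Bad∪Covered 0<δ N C σ → Bad 0<δ N σ ⊎ F σ
      split σ o = decide em o
        where
        decide : Dec (Bad 0<δ N σ) → Bad∪Covered 0<δ N C σ → Bad 0<δ N σ ⊎ F σ
        decide (yes bad) _          = inj₁ bad
        decide (no ¬bad) (inj₁ bad) = inj₁ bad
        decide (no ¬bad) (inj₂ cov) = inj₂ (cov , ¬bad)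
      μF≤ : level μ n F ≤ δ * K ⁻¹
      μF≤ = ≤-trans (level-mono μ n F (Covered C) λ _ _ → proj₁)
        (≤-trans (level-Covered-≤ μ C n) (∑C≤ n))

    null-transfer : Null ν (∁ (Summable ∘ xs)) → ∀ {A : Pred Cantor 0ℓ} → Null μ A → Null ν A
    null-transfer null-∁ {A} null-A = Null-from-open ν open-cover
      where
      open-cover : ∀ ε → 0# < ε →
        ∃[ P ] ExtensionClosed P × (∀ {ω} → A ω → ∃[ n ] P (ω ↾ n)) × (∀ m → level ν m P ≤ ε)
      open-cover ε 0<ε =
        let δ = ε * (# 8) ⁻¹
            0<δ = ÷-pos 7 0<ε
            E , E-covers , ∑E≤δ = null-∁ δ 0<δ
            N , Bad≤ = ∃-Bad-small 0<δ 0<δ E E-covers ∑E≤δ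
            K , 0<K , transfer = level-bound ν μ suppν suppμ N (<⇒≤ 0<δ)
            C , C-covers , ∑C≤ = null-A (δ * K ⁻¹) (*-pos 0<δ (⁻¹-pos 0<K))
            O = Bad∪Covered 0<δ N C
            O-ext = λ σ ρ → [ inj₁ ∘ Bad-extensionClosed 0<δ N σ ρ , inj₂ ∘ Covered-extensionClosed C σ ρ ]′
            O≤8δ = level-Bad∪Covered 0<δ N Bad≤ 0<K transfer C ∑C≤
        in O , O-ext , (λ a → let n , cov = Covered-covers C-covers a in n , inj₂ cov) ,
           -- The estimate starts at level N; level sums of an open set increase, so it also bounds
           -- the earlier levels.
           λ m → ≤-trans (level-≤-+ ν O-ext m N) (≤-trans
             (≤-reflexive (reflexive (≡.cong (λ k → level ν k O) (ℕ.+-comm m N))))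
             (≤-trans (O≤8δ m) (≤-reflexive (*-÷-cancel (0<⇒≉0 (#-pos 7))))))

corollary1p8 : ExcludedMiddle 0ℓ → (R : CompleteOrderedField) →
    let open OverReals R in
    ∀ {ℓ₁ ℓ₂ : Level}
    (S : Pred Measure ℓ₁) (_≼_ : Rel Measure ℓ₂) →
    S ⊆ FullSupport →
    (∀ {ν μ} → ν ≼ μ → S ν × S μ) →
    (∀ {ν} → S ν → ν ≼ ν) →
    (ν μ : Measure) → Computable ν → Computable μ →
    (suppν : FullSupport ν) → FullSupport μ →
    HasMeasureOne ν (MR₂ _≼_ ν suppν) →
    ν ≼ μ →
    ν ≪ μ
corollary1p8 em R S _≼_ _ _ _ ν μ _ computable-μ suppν suppμ MR₂-full ν≼μ _ null-A =
  null-transfer ν μ suppν suppμ null-∁Summable null-A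
  where
  open CompleteOrderedField R using (≤-trans)
  open OverReals R
  open LevelSums em R using (∑-mono)
  open Affinity em R
  open AbsoluteContinuity em R
  null-∁Summable : Null ν (∁ (λ ω → Summable (λ n → x ν μ suppν suppμ (ω ↾ n))))
  null-∁Summable ε 0<ε = let C , covers , ∑≤ε = MR₂-full ε 0<ε in
    -- The same cover works: at a point of `MR₂` the squared distances to μ are summable and
    -- dominate x, so divergence of x puts ω outside `MR₂`.
    C , (λ {ω} ¬summable → covers λ ω∈MR₂ →
          let b , ∑H²≤b = ω∈MR₂ μ computable-μ suppμ ν≼μ
          in ¬summable (b , λ n → ≤-trans (∑-mono n λ i _ → x≤H² ν μ suppν suppμ ω i) (∑H²≤b n)))
      , ∑≤ε
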